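{- Let $n\ge 3$ be an odd integer and $G=\langle\sigma,\tau:\sigma^n=\tau^2=1,\ \tau\sigma\tau^{ -1}=\sigma^{ -1}\rangle\simeq D_n$. Then there is an isomorphism of $G$-lattices $\widetilde{M}_-\oplus\mathbb{Z}[G/\langle\tau\rangle]\simeq\mathbb{Z}[G]\oplus\mathbb{Z}$.
   Context: $D_n$ is the dihedral group of order $2n$. A $G$-lattice is a finitely generated $\mathbb{Z}[G]$-module that is torsion-free as an abelian group; $\mathbb{Z}$ denotes the rank-one lattice with trivial $G$-action, and for a subgroup $S\le G$, $\mathbb{Z}[G/S]$ is the permutation lattice on the left cosets of $S$. The $G$-lattice $\widetilde{M}_-$ of rank $n+1$ is the free abelian group with basis $w_0,\ldots,w_{n-1},w'$ (indices modulo $n$) and action $\sigma\cdot w_i=w_{i+1}$, $\tau\cdot w_i=-w_{ -i}$, $\sigma\cdot w'=w'$, $\tau\cdot w'=w'-\sum_{0\le i\le n-1}w_i$. -}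

module Defs where

open import Algebra.Bundles using (Group; AbelianGroup; Ring)
open import Algebra.Module.Bundles using (LeftModule)
open import Algebra.Module.Morphism.Structures using (module LeftModuleMorphisms)
open import Algebra.Morphism.Structures using (module GroupMorphisms)
open import Data.Bool.Base using (if_then_else_)
open import Data.Fin.Base using (Fin; zero; suc; toℕ; splitAt)
open import Data.Integer.Base as ℤ using (ℤ; 0ℤ; 1ℤ)
open import Data.Integer.Tactic.RingSolver using (solve-∀)
open import Data.Nat.Base as ℕ using (ℕ; zero; suc; NonZero)
open import Data.Nat.DivMod using (_%_; _mod_)
open import Data.Parity.Base as ℙ using (Parity; 0ℙ; 1ℙ)
open import Data.Product.Base using (_×_; _,_; proj₁; proj₂; ∃-syntax; Σ-syntax)
open import Data.Sum.Base using (inj₁; inj₂)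
open import Data.Sum.Properties using ([,]-map)
open import Data.Vec.Functional using (Vector; _++_)
open import Function.Base using (_∘_)
open import Function.Bundles using (Func; Inverse; mk↔ₛ′; mk⇔)
open import Function.Construct.Composition using (_↔-∘_)
open import Level using (0ℓ)
open import Relation.Binary.Bundles using (Setoid)
open import Relation.Binary.PropositionalEquality as ≡ using (_≡_; _≢_; cong; cong₂)
open import Relation.Nullary.Decidable using (Dec; yes; no; does; map′; does-⇔; dec-true; dec-false)
open import Relation.Nullary.Negation using (¬_; contradiction)

import Algebra.Definitions.RawMonoid as RawMonoidDefinitions
import Algebra.Module.Construct.DirectProduct as DirectProduct
import Algebra.Module.Construct.TensorUnit as TensorUnit
import Algebra.Properties.AbelianGroup as AbelianGroupProperties
import Algebra.Properties.CommutativeMonoid.Sum as Sum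
import Algebra.Properties.Group as GroupProperties
import Algebra.Properties.Monoid.Mult as Mult
import Data.Fin.Properties as Fin
import Data.Integer.Properties as ℤ
import Data.Nat.DivMod as ℕ
import Data.Nat.Properties as ℕ
import Data.Parity.Properties as ℙ
import Relation.Binary.Reasoning.Setoid as ≈-Reasoning

record FiniteGroup : Set₁ where
  field
    group : Group 0ℓ 0ℓ
    order : ℕ
    enum  : Inverse (≡.setoid (Fin order)) (Group.setoid group)

  open Group group public
  open GroupProperties group public using (⁻¹-anti-homo-∙; ε⁻¹≈ε)

  elt : Fin order → Carrier
  elt = Inverse.to enum

  index : Carrier → Fin order
  index = Inverse.from enum

  elt-index : ∀ x → elt (index x) ≈ x
  elt-index x = Inverse.inverseˡ enum ≡.refl

  index-elt : ∀ k → index (elt k) ≡ k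
  index-elt k = Inverse.inverseʳ enum refl

  infix 4 _≟_

  _≟_ : ∀ x y → Dec (x ≈ y)
  x ≟ y = map′
    (λ eq → trans (sym (elt-index x)) (trans (reflexive (cong elt eq)) (elt-index y)))
    (Inverse.from-cong enum)
    (index x Fin.≟ index y)

-- Decidability of membership holds classically for every subgroup; it is
-- needed here for ℤ[G/S] to have indicator functions of cosets.
record Subgroup (G : FiniteGroup) : Set₁ where
  open FiniteGroup G
  field
    _∈S     : Carrier → Set
    ∈S-resp : ∀ {x y} → x ≈ y → x ∈S → y ∈S
    ε∈S     : ε ∈S
    ∙∈S     : ∀ {x y} → x ∈S → y ∈S → (x ∙ y) ∈S
    ⁻¹∈S    : ∀ {x} → x ∈S → (x ⁻¹) ∈S
    _∈S?    : ∀ x → Dec (x ∈S)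

module _ (G : FiniteGroup) where
  open FiniteGroup G

  data Generated (g : Carrier) : Carrier → Set where
    gen  : Generated g g
    unit : Generated g ε
    mul  : ∀ {x y} → Generated g x → Generated g y → Generated g (x ∙ y)
    inv  : ∀ {x} → Generated g x → Generated g (x ⁻¹)
    resp : ∀ {x y} → x ≈ y → Generated g x → Generated g y

  ⟨_⟩by_ : (g : Carrier) → (∀ x → Dec (Generated g x)) → Subgroup G
  ⟨ g ⟩by dec = record
    { _∈S     = Generated g
    ; ∈S-resp = resp
    ; ε∈S     = unit
    ; ∙∈S     = mul
    ; ⁻¹∈S    = inv
    ; _∈S?    = dec
    }

record FiniteGSet (G : FiniteGroup) : Set₁ where
  private module G = FiniteGroup G
  field
    setoid : Setoid 0ℓ 0ℓ
  open Setoid setoid public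
  infixr 7 _·_
  infix 4 _≟_
  field
    _·_        : G.Carrier → Carrier → Carrier
    ·-cong     : ∀ {g h x y} → g G.≈ h → x ≈ y → g · x ≈ h · y
    ·-identity : ∀ x → G.ε · x ≈ x
    ·-assoc    : ∀ g h x → (g G.∙ h) · x ≈ g · h · x
    _≟_        : ∀ x y → Dec (x ≈ y)
    size       : ℕ
    -- an enumeration, possibly with repetitions up to ≈
    point      : Fin size → Carrier
    covers     : ∀ x → ∃[ k ] point k ≈ x

module _ (G : FiniteGroup) where
  open FiniteGroup G
  open ≈-Reasoning setoid

  leftRegular : FiniteGSet G
  leftRegular = record
    { setoid = setoid ; _·_ = _∙_ ; ·-cong = ∙-cong ; ·-identity = identityˡ
    ; ·-assoc = assoc ; _≟_ = _≟_ ; size = order ; point = elt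
    ; covers = λ x → index x , elt-index x
    }

  -- G/S is presented as a setoid on G, with x and y identified when
  -- xS = yS, that is, when x⁻¹y ∈ S.
  leftCosets : Subgroup G → FiniteGSet G
  leftCosets S = record
    { setoid = record
      { Carrier = Carrier
      ; _≈_ = λ x y → (x ⁻¹ ∙ y) ∈S
      ; isEquivalence = record
        { refl  = λ {x} → ∈S-resp (sym (inverseˡ x)) ε∈S
        ; sym   = λ {x} {y} p → ∈S-resp (swap x y) (⁻¹∈S p)
        ; trans = λ {x} {y} {z} p q → ∈S-resp (cancel x y z) (∙∈S p q)
        }
      }
    ; _·_ = _∙_
    ; ·-cong = λ {g} {h} {x} {y} g≈h → ∈S-resp (translate g h x y g≈h)
    ; ·-identity = λ x → fromEq (identityˡ x)
    ; ·-assoc = λ g h x → fromEq (assoc g h x)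
    ; _≟_ = λ x y → (x ⁻¹ ∙ y) ∈S?
    ; size = order
    ; point = elt
    ; covers = λ x → index x , fromEq (elt-index x)
    }
    where
    open Subgroup S
    open GroupProperties group using (⁻¹-involutive)
    fromEq : ∀ {x y} → x ≈ y → (x ⁻¹ ∙ y) ∈S
    fromEq {x} {y} x≈y = ∈S-resp (trans (sym (inverseˡ x)) (∙-congˡ x≈y)) ε∈S
    swap : ∀ x y → (x ⁻¹ ∙ y) ⁻¹ ≈ y ⁻¹ ∙ x
    swap x y = trans (⁻¹-anti-homo-∙ _ _) (∙-congˡ (⁻¹-involutive x))
    cancel : ∀ x y z → (x ⁻¹ ∙ y) ∙ (y ⁻¹ ∙ z) ≈ x ⁻¹ ∙ z
    cancel x y z = begin
      (x ⁻¹ ∙ y) ∙ (y ⁻¹ ∙ z)  ≈⟨ assoc _ _ _ ⟨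
      ((x ⁻¹ ∙ y) ∙ y ⁻¹) ∙ z  ≈⟨ ∙-congʳ (assoc _ _ _) ⟩
      (x ⁻¹ ∙ (y ∙ y ⁻¹)) ∙ z  ≈⟨ ∙-congʳ (∙-congˡ (inverseʳ y)) ⟩
      (x ⁻¹ ∙ ε) ∙ z           ≈⟨ ∙-congʳ (identityʳ _) ⟩
      x ⁻¹ ∙ z                 ∎
    translate : ∀ g h x y → g ≈ h → x ⁻¹ ∙ y ≈ (g ∙ x) ⁻¹ ∙ (h ∙ y)
    translate g h x y g≈h = sym (begin
      (g ∙ x) ⁻¹ ∙ (h ∙ y)     ≈⟨ ∙-congʳ (⁻¹-anti-homo-∙ g x) ⟩
      (x ⁻¹ ∙ g ⁻¹) ∙ (h ∙ y)  ≈⟨ ∙-congˡ (∙-congʳ g≈h) ⟨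
      (x ⁻¹ ∙ g ⁻¹) ∙ (g ∙ y)  ≈⟨ assoc _ _ _ ⟩
      x ⁻¹ ∙ (g ⁻¹ ∙ (g ∙ y))  ≈⟨ ∙-congˡ (assoc _ _ _) ⟨
      x ⁻¹ ∙ ((g ⁻¹ ∙ g) ∙ y)  ≈⟨ ∙-congˡ (∙-congʳ (inverseˡ g)) ⟩
      x ⁻¹ ∙ (ε ∙ y)           ≈⟨ ∙-congˡ (identityˡ y) ⟩
      x ⁻¹ ∙ y                 ∎)

module _ {R : Ring 0ℓ 0ℓ} (M : LeftModule R 0ℓ 0ℓ) where
  private module R = Ring R
  open LeftModule M
  open RawMonoidDefinitions +ᴹ-rawMonoid using (sum) renaming (_×_ to _⊗_)

  FinitelyGenerated : Set
  FinitelyGenerated =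
    Σ[ k ∈ ℕ ] Σ[ g ∈ Vector Carrierᴹ k ]
    ∀ m → Σ[ c ∈ Vector R.Carrier k ] m ≈ᴹ sum (λ i → c i *ₗ g i)

  TorsionFree : Set
  TorsionFree = ∀ k .{{_ : NonZero k}} m → k ⊗ m ≈ᴹ 0ᴹ → m ≈ᴹ 0ᴹ

module ModuleSum {R : Ring 0ℓ 0ℓ} (M : LeftModule R 0ℓ 0ℓ) where
  private module R = Ring R
  open LeftModule M
  open Sum +ᴹ-commutativeMonoid public
  open Sum R.+-commutativeMonoid using () renaming (sum to sumᴿ)
  open ≈-Reasoning ≈ᴹ-setoid

  *ₗ-sum : ∀ {n} r (t : Vector Carrierᴹ n) → r *ₗ sum t ≈ᴹ sum (λ k → r *ₗ t k)
  *ₗ-sum {zero}  r t = *ₗ-zeroʳ r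
  *ₗ-sum {suc n} r t = ≈ᴹ-trans (*ₗ-distribˡ r _ _) (+ᴹ-congˡ (*ₗ-sum r (t ∘ suc)))

  sum-*ₗ : ∀ {n} (t : Vector R.Carrier n) m → sumᴿ t *ₗ m ≈ᴹ sum (λ k → t k *ₗ m)
  sum-*ₗ {zero}  t m = *ₗ-zeroˡ m
  sum-*ₗ {suc n} t m = ≈ᴹ-trans (*ₗ-distribʳ m _ _) (+ᴹ-congˡ (sum-*ₗ (t ∘ suc) m))

  sum-zero : ∀ {n} (t : Vector Carrierᴹ n) → (∀ k → t k ≈ᴹ 0ᴹ) → sum t ≈ᴹ 0ᴹ
  sum-zero {n} t t≈0 = ≈ᴹ-trans (sum-cong-≋ t≈0) (sum-replicate-zero n)

  sum-single : ∀ {n} (t : Vector Carrierᴹ n) j → (∀ k → k ≢ j → t k ≈ᴹ 0ᴹ) → sum t ≈ᴹ t j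
  sum-single t zero    off = ≈ᴹ-trans (+ᴹ-congˡ (sum-zero (t ∘ suc) (λ k → off (suc k) λ ())))
                                      (+ᴹ-identityʳ _)
  sum-single t (suc j) off = ≈ᴹ-trans
    (+ᴹ-cong (off zero λ ())
             (sum-single (t ∘ suc) j (λ k k≢j → off (suc k) (k≢j ∘ Fin.suc-injective))))
    (+ᴹ-identityˡ _)

  sum-++ : ∀ {m n} (s : Vector Carrierᴹ m) (t : Vector Carrierᴹ n) →
           sum (s ++ t) ≈ᴹ sum s +ᴹ sum t
  sum-++ {zero}  s t = ≈ᴹ-sym (+ᴹ-identityˡ _)
  sum-++ {suc m} s t = begin
    s zero +ᴹ sum ((s ++ t) ∘ suc)
      ≈⟨ +ᴹ-congˡ (sum-cong-≋ λ k → ≈ᴹ-reflexive ([,]-map (splitAt m k))) ⟩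
    s zero +ᴹ sum ((s ∘ suc) ++ t)         ≈⟨ +ᴹ-congˡ (sum-++ (s ∘ suc) t) ⟩
    s zero +ᴹ (sum (s ∘ suc) +ᴹ sum t)     ≈⟨ +ᴹ-assoc _ _ _ ⟨
    (s zero +ᴹ sum (s ∘ suc)) +ᴹ sum t     ∎

ℤ-Module : Set₁
ℤ-Module = LeftModule ℤ.+-*-ring 0ℓ 0ℓ

ℤ¹ : ℤ-Module
ℤ¹ = TensorUnit.leftModule

ℤ-sum : ∀ {n} → Vector ℤ n → ℤ
ℤ-sum = ModuleSum.sum ℤ¹

-- The module of ℤ-valued functions on X. For finite X it is the free
-- abelian group on X, a function f standing for Σₓ f(x)·x.
ℤ^ : Setoid 0ℓ 0ℓ → ℤ-Module
ℤ^ X = record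
  { Carrierᴹ = Func X (≡.setoid ℤ)
  ; _≈ᴹ_ = λ f g → ∀ x → to f x ≡ to g x
  ; _+ᴹ_ = λ f g → record
    { to = λ x → to f x ℤ.+ to g x ; cong = λ e → cong₂ ℤ._+_ (Func.cong f e) (Func.cong g e) }
  ; _*ₗ_ = λ a f → record
    { to = λ x → a ℤ.* to f x ; cong = λ e → cong (a ℤ.*_) (Func.cong f e) }
  ; 0ᴹ = record { to = λ _ → 0ℤ ; cong = λ _ → ≡.refl }
  ; -ᴹ_ = λ f → record { to = λ x → ℤ.- to f x ; cong = λ e → cong ℤ.-_ (Func.cong f e) }
  ; isLeftModule = record
    { isLeftSemimodule = record
      { +ᴹ-isCommutativeMonoid = record
        { isMonoid = record
          { isSemigroup = record
            { isMagma = record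
              { isEquivalence = record
                { refl = λ _ → ≡.refl
                ; sym = λ e x → ≡.sym (e x)
                ; trans = λ e e′ x → ≡.trans (e x) (e′ x)
                }
              ; ∙-cong = λ e e′ x → cong₂ ℤ._+_ (e x) (e′ x)
              }
            ; assoc = λ f g h x → ℤ.+-assoc (to f x) (to g x) (to h x)
            }
          ; identity = (λ f x → ℤ.+-identityˡ (to f x)) , (λ f x → ℤ.+-identityʳ (to f x))
          }
        ; comm = λ f g x → ℤ.+-comm (to f x) (to g x)
        }
      ; isPreleftSemimodule = record
        { *ₗ-cong = λ e e′ x → cong₂ ℤ._*_ e (e′ x)
        ; *ₗ-zeroˡ = λ f x → ℤ.*-zeroˡ (to f x)
        ; *ₗ-distribʳ = λ f a b x → ℤ.*-distribʳ-+ (to f x) a b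
        ; *ₗ-identityˡ = λ f x → ℤ.*-identityˡ (to f x)
        ; *ₗ-assoc = λ a b f x → ℤ.*-assoc a b (to f x)
        ; *ₗ-zeroʳ = λ a x → ℤ.*-zeroʳ a
        ; *ₗ-distribˡ = λ a f g x → ℤ.*-distribˡ-+ a (to f x) (to g x)
        }
      }
    ; -ᴹ‿cong = λ e x → cong ℤ.-_ (e x)
    ; -ᴹ‿inverse = (λ f x → ℤ.+-inverseˡ (to f x)) , (λ f x → ℤ.+-inverseʳ (to f x))
    }
  }
  where open Func using (to)

module _ (X : Setoid 0ℓ 0ℓ) where
  open Setoid X
  open ModuleSum (ℤ^ X) using (sum)

  sum-at : ∀ {n} (t : Vector (Func X (≡.setoid ℤ)) n) x →
           Func.to (sum t) x ≡ ℤ-sum (λ k → Func.to (t k) x)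
  sum-at {zero}  t x = ≡.refl
  sum-at {suc n} t x = cong (ℤ._+_ (Func.to (t zero) x)) (sum-at (t ∘ suc) x)

  module Delta (_≟_ : ∀ x y → Dec (x ≈ y)) where

    δ : Carrier → Func X (≡.setoid ℤ)
    δ y = record
      { to = λ x → if does (x ≟ y) then 1ℤ else 0ℤ
      ; cong = λ {x} {x′} e → cong (if_then 1ℤ else 0ℤ)
          (does-⇔ (mk⇔ (trans (sym e)) (trans e)) (x ≟ y) (x′ ≟ y))
      }

    δ-yes : ∀ {x y} → x ≈ y → Func.to (δ y) x ≡ 1ℤ
    δ-yes {x} {y} e = cong (if_then 1ℤ else 0ℤ) (dec-true (x ≟ y) e)

    δ-no : ∀ {x y} → ¬ x ≈ y → Func.to (δ y) x ≡ 0ℤ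
    δ-no {x} {y} e = cong (if_then 1ℤ else 0ℤ) (dec-false (x ≟ y) e)

    spanning : ∀ {n} (p : Vector Carrier n) (f : Func X (≡.setoid ℤ)) →
               (∀ x → (∀ k → ¬ p k ≈ x) → Func.to f x ≡ 0ℤ) →
               Σ[ c ∈ Vector ℤ n ]
               LeftModule._≈ᴹ_ (ℤ^ X) f (sum (λ k → LeftModule._*ₗ_ (ℤ^ X) (c k) (δ (p k))))
    spanning {zero}  p f supp = (λ ()) , λ x → supp x λ ()
    spanning {suc n} p f supp = c , λ x → ≡.sym (recover x)
      where
      open LeftModule (ℤ^ X)
      open ≡.≡-Reasoning
      p₀ = p zero
      a = Func.to f p₀
      f′ = f +ᴹ -ᴹ (a *ₗ δ p₀)
      supp′ : ∀ x → (∀ k → ¬ p (suc k) ≈ x) → Func.to f′ x ≡ 0ℤ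
      supp′ x out with x ≟ p₀
      ... | yes x≈p₀ rewrite Func.cong f x≈p₀ | ℤ.*-identityʳ a = ℤ.+-inverseʳ a
      ... | no  x≉p₀ rewrite supp x (λ { zero e → x≉p₀ (sym e) ; (suc k) → out k })
                           | ℤ.*-zeroʳ a = ≡.refl
      rec = spanning (p ∘ suc) f′ supp′
      c : Vector ℤ (suc n)
      c zero    = a
      c (suc k) = proj₁ rec k
      recover : ∀ x → Func.to (sum (λ k → c k *ₗ δ (p k))) x ≡ Func.to f x
      recover x = begin
        Func.to (a *ₗ δ p₀) x ℤ.+ _
          ≡⟨ cong (ℤ._+_ (Func.to (a *ₗ δ p₀) x)) (proj₂ rec x) ⟨
        d ℤ.+ (Func.to f x ℤ.+ ℤ.- d)   ≡⟨ ℤ.+-comm d _ ⟩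
        (Func.to f x ℤ.+ ℤ.- d) ℤ.+ d   ≡⟨ ℤ.+-assoc (Func.to f x) _ d ⟩
        Func.to f x ℤ.+ (ℤ.- d ℤ.+ d)   ≡⟨ cong (ℤ._+_ (Func.to f x)) (ℤ.+-inverseˡ d) ⟩
        Func.to f x ℤ.+ 0ℤ              ≡⟨ ℤ.+-identityʳ _ ⟩
        Func.to f x                     ∎
        where d = Func.to (a *ₗ δ p₀) x

    finitelyGenerated : ∀ {n} (p : Vector Carrier n) → (∀ x → ∃[ k ] p k ≈ x) →
                        FinitelyGenerated (ℤ^ X)
    finitelyGenerated {n} p covers = n , δ ∘ p , λ f →
      spanning p f (λ x out → contradiction (proj₂ (covers x)) (out (proj₁ (covers x))))

module _ where
  open RawMonoidDefinitions (LeftModule.+ᴹ-rawMonoid ℤ¹) using () renaming (_×_ to _⊗_)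

  ×-as-* : ∀ k a → k ⊗ a ≡ ℤ.+ k ℤ.* a
  ×-as-* zero    a = ≡.refl
  ×-as-* (suc k) a = ≡.trans (cong (ℤ._+_ a) (×-as-* k a)) (≡.sym (ℤ.suc-* (ℤ.+ k) a))

  ℤ¹-torsionFree : TorsionFree ℤ¹
  ℤ¹-torsionFree (suc k) a e with ℤ.i*j≡0⇒i≡0∨j≡0 (ℤ.+ suc k) (≡.trans (≡.sym (×-as-* (suc k) a)) e)
  ... | inj₂ a≡0 = a≡0

  ℤ^-torsionFree : ∀ X → TorsionFree (ℤ^ X)
  ℤ^-torsionFree X k f e x = ℤ¹-torsionFree k (Func.to f x) (≡.trans (≡.sym (at k)) (e x))
    where
    open RawMonoidDefinitions (LeftModule.+ᴹ-rawMonoid (ℤ^ X)) using () renaming (_×_ to _⊠_)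
    at : ∀ k → Func.to (k ⊠ f) x ≡ k ⊗ Func.to f x
    at zero    = ≡.refl
    at (suc k) = cong (ℤ._+_ (Func.to f x)) (at k)

ℤ¹-finitelyGenerated : FinitelyGenerated ℤ¹
ℤ¹-finitelyGenerated = 1 , (λ _ → 1ℤ) , λ a → (λ _ → a) ,
  ≡.sym (≡.trans (ℤ.+-identityʳ (a ℤ.* 1ℤ)) (ℤ.*-identityʳ a))

record Representation (G : FiniteGroup) : Set₁ where
  private module G = FiniteGroup G
  field
    space : ℤ-Module
  open LeftModule space public
  infixr 7 _·_
  field
    _·_        : G.Carrier → Carrierᴹ → Carrierᴹ
    ·-cong     : ∀ {g h x y} → g G.≈ h → x ≈ᴹ y → g · x ≈ᴹ h · y
    ·-+ᴹ       : ∀ g x y → g · (x +ᴹ y) ≈ᴹ g · x +ᴹ g · y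
    ·-*ₗ       : ∀ g a x → g · (a *ₗ x) ≈ᴹ a *ₗ (g · x)
    ·-identity : ∀ x → G.ε · x ≈ᴹ x
    ·-assoc    : ∀ g h x → (g G.∙ h) · x ≈ᴹ g · h · x

module GroupRing (G : FiniteGroup) where
  private module G = FiniteGroup G
  open G using (_∙_; _⁻¹; ε; elt; index; order)

  coefficients : ℤ-Module
  coefficients = ℤ^ G.setoid

  private module C = LeftModule coefficients
  open C using () renaming (Carrierᴹ to Element)
  open Func using (to)
  open Delta G.setoid G._≟_ public

  -- r : Element stands for Σ_g r(g)·g, so that the product is convolution.
  infixl 7 _⋆_

  _⋆_ : Element → Element → Element
  r ⋆ s = record
    { to   = λ x → ℤ-sum (λ k → to r (elt k) ℤ.* to s (elt k ⁻¹ ∙ x))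
    ; cong = λ e → ModuleSum.sum-cong-≋ ℤ¹ {order}
        (λ k → cong (to r (elt k) ℤ.*_) (Func.cong s (G.∙-congˡ e)))
    }

  module Extend (V : Representation G) where
    open Representation V
    open ModuleSum space
    open ≈-Reasoning ≈ᴹ-setoid

    infixr 7 _▷_

    _▷_ : Element → Carrierᴹ → Carrierᴹ
    r ▷ m = sum (λ k → to r (elt k) *ₗ elt k · m)

    ·-0ᴹ : ∀ g → g · 0ᴹ ≈ᴹ 0ᴹ
    ·-0ᴹ g = begin
      g · 0ᴹ           ≈⟨ ·-cong G.refl (*ₗ-zeroˡ 0ᴹ) ⟨
      g · (0ℤ *ₗ 0ᴹ)   ≈⟨ ·-*ₗ g 0ℤ 0ᴹ ⟩
      0ℤ *ₗ (g · 0ᴹ)   ≈⟨ *ₗ-zeroˡ _ ⟩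
      0ᴹ               ∎

    ·-sum : ∀ {n} g (t : Vector Carrierᴹ n) → g · sum t ≈ᴹ sum (λ k → g · t k)
    ·-sum {zero}  g t = ·-0ᴹ g
    ·-sum {suc n} g t = ≈ᴹ-trans (·-+ᴹ g _ _) (+ᴹ-congˡ (·-sum g (t ∘ suc)))

    sum-translate : ∀ h (F : G.Carrier → Carrierᴹ) → (∀ {x y} → x G.≈ y → F x ≈ᴹ F y) →
                    sum (λ k → F (h ⁻¹ ∙ elt k)) ≈ᴹ sum (F ∘ elt)
    sum-translate h F F-cong = ≈ᴹ-sym (≈ᴹ-trans (sum-permute (F ∘ elt) π)
        (sum-cong-≋ {order} λ k → F-cong (G.elt-index (h ⁻¹ ∙ elt k))))
      where
      cycle : ∀ g g′ → g ∙ g′ G.≈ ε → ∀ k → index (g ∙ elt (index (g′ ∙ elt k))) ≡ k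
      cycle g g′ e k = ≡.trans
        (Inverse.from-cong G.enum
          (G.trans (G.∙-congˡ (G.elt-index _))
          (G.trans (G.sym (G.assoc g g′ (elt k)))
          (G.trans (G.∙-congʳ e) (G.identityˡ _)))))
        (G.index-elt k)
      π = mk↔ₛ′ (λ k → index (h ⁻¹ ∙ elt k)) (λ k → index (h ∙ elt k))
                (cycle (h ⁻¹) h (G.inverseˡ h)) (cycle h (h ⁻¹) (G.inverseʳ h))

    ▷-cong : ∀ {r s m m′} → r C.≈ᴹ s → m ≈ᴹ m′ → r ▷ m ≈ᴹ s ▷ m′
    ▷-cong r≈s m≈m′ = sum-cong-≋ {order} λ k → *ₗ-cong (r≈s (elt k)) (·-cong G.refl m≈m′)

    ▷-zeroˡ : ∀ m → C.0ᴹ ▷ m ≈ᴹ 0ᴹ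
    ▷-zeroˡ m = sum-zero {order} _ λ k → *ₗ-zeroˡ _

    ▷-zeroʳ : ∀ r → r ▷ 0ᴹ ≈ᴹ 0ᴹ
    ▷-zeroʳ r = sum-zero {order} _ λ k → ≈ᴹ-trans (*ₗ-congˡ (·-0ᴹ (elt k))) (*ₗ-zeroʳ _)

    ▷-distribʳ : ∀ m r s → (r C.+ᴹ s) ▷ m ≈ᴹ r ▷ m +ᴹ s ▷ m
    ▷-distribʳ m r s = ≈ᴹ-trans (sum-cong-≋ {order} λ k → *ₗ-distribʳ _ _ _) (∑-distrib-+ {order} _ _)

    ▷-distribˡ : ∀ r m m′ → r ▷ (m +ᴹ m′) ≈ᴹ r ▷ m +ᴹ r ▷ m′
    ▷-distribˡ r m m′ = ≈ᴹ-trans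
      (sum-cong-≋ {order} λ k → ≈ᴹ-trans (*ₗ-congˡ (·-+ᴹ _ _ _)) (*ₗ-distribˡ _ _ _)) (∑-distrib-+ {order} _ _)

    δ-▷ : ∀ g m → δ g ▷ m ≈ᴹ g · m
    δ-▷ g m = begin
      δ g ▷ m                                       ≈⟨ sum-single {order} _ (index g) off ⟩
      to (δ g) (elt (index g)) *ₗ elt (index g) · m
        ≈⟨ *ₗ-cong (δ-yes (G.elt-index g)) (·-cong (G.elt-index g) ≈ᴹ-refl) ⟩
      1ℤ *ₗ g · m                                   ≈⟨ *ₗ-identityˡ _ ⟩
      g · m                                         ∎
      where
      off : ∀ k → k ≢ index g → to (δ g) (elt k) *ₗ elt k · m ≈ᴹ 0ᴹ
      off k k≢ = ≈ᴹ-trans (*ₗ-congʳ (δ-no λ e →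
        k≢ (≡.trans (≡.sym (G.index-elt k)) (Inverse.from-cong G.enum e)))) (*ₗ-zeroˡ _)

    ▷-identityˡ : ∀ m → δ ε ▷ m ≈ᴹ m
    ▷-identityˡ m = ≈ᴹ-trans (δ-▷ ε m) (·-identity m)

    ▷-assoc : ∀ r s m → (r ⋆ s) ▷ m ≈ᴹ r ▷ s ▷ m
    ▷-assoc r s m = begin
      sum (λ k → ℤ-sum (λ j → to r (elt j) ℤ.* to s (elt j ⁻¹ ∙ elt k)) *ₗ elt k · m)
        ≈⟨ sum-cong-≋ {order} (λ k → sum-*ₗ {order} _ _) ⟩
      sum (λ k → sum (λ j → (to r (elt j) ℤ.* to s (elt j ⁻¹ ∙ elt k)) *ₗ elt k · m))
        ≈⟨ ∑-comm {order} {order} _ ⟩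
      sum (λ j → sum (λ k → (to r (elt j) ℤ.* to s (elt j ⁻¹ ∙ elt k)) *ₗ elt k · m))
        ≈⟨ sum-cong-≋ inner ⟩
      r ▷ s ▷ m ∎
      where
      inner : ∀ j → sum (λ k → (to r (elt j) ℤ.* to s (elt j ⁻¹ ∙ elt k)) *ₗ elt k · m)
                    ≈ᴹ to r (elt j) *ₗ elt j · (s ▷ m)
      inner j = begin
        sum (λ k → (to r h ℤ.* to s (h ⁻¹ ∙ elt k)) *ₗ elt k · m)
          ≈⟨ sum-cong-≋ {order} (λ k → ≈ᴹ-trans (*ₗ-assoc _ _ _)
               (*ₗ-congˡ (*ₗ-congˡ (≈ᴹ-trans (·-cong (back k) ≈ᴹ-refl) (·-assoc _ _ _))))) ⟩
        sum (λ k → to r h *ₗ F (h ⁻¹ ∙ elt k))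
          ≈⟨ *ₗ-sum {order} _ _ ⟨
        to r h *ₗ sum (λ k → F (h ⁻¹ ∙ elt k))
          ≈⟨ *ₗ-congˡ (sum-translate h F F-cong) ⟩
        to r h *ₗ sum (λ k → to s (elt k) *ₗ h · elt k · m)
          ≈⟨ *ₗ-congˡ (sum-cong-≋ {order} λ k → ·-*ₗ _ _ _) ⟨
        to r h *ₗ sum (λ k → h · (to s (elt k) *ₗ elt k · m))
          ≈⟨ *ₗ-congˡ (·-sum {order} _ _) ⟨
        to r h *ₗ h · (s ▷ m) ∎
        where
        h = elt j
        F : G.Carrier → Carrierᴹ
        F y = to s y *ₗ h · y · m
        F-cong : ∀ {x y} → x G.≈ y → F x ≈ᴹ F y
        F-cong e = *ₗ-cong (Func.cong s e) (·-cong G.refl (·-cong e ≈ᴹ-refl))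
        back : ∀ k → elt k G.≈ h ∙ (h ⁻¹ ∙ elt k)
        back k = G.sym (G.trans (G.sym (G.assoc _ _ _))
                   (G.trans (G.∙-congʳ (G.inverseʳ h)) (G.identityˡ _)))

  -- (g · f)(x) = f(g⁻¹x), so that the indicator function of y is sent
  -- to that of gy.
  permutation : FiniteGSet G → Representation G
  permutation X = record
    { space = ℤ^ X.setoid
    ; _·_ = λ g f → record
      { to = λ x → to f (g ⁻¹ X.· x) ; cong = λ e → Func.cong f (X.·-cong G.refl e) }
    ; ·-cong = λ {g} {h} {f} {f′} g≈h f≈f′ x → ≡.trans (f≈f′ _)
        (Func.cong f′ (X.·-cong (G.⁻¹-cong g≈h) X.refl))
    ; ·-+ᴹ = λ _ _ _ _ → ≡.refl
    ; ·-*ₗ = λ _ _ _ _ → ≡.refl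
    ; ·-identity = λ f x → Func.cong f
        (X.trans (X.·-cong G.ε⁻¹≈ε X.refl) (X.·-identity x))
    ; ·-assoc = λ g h f x → Func.cong f
        (X.trans (X.·-cong (G.⁻¹-anti-homo-∙ g h) X.refl) (X.·-assoc _ _ x))
    }
    where module X = FiniteGSet X

  private
    module L = Extend (permutation (leftRegular G))

    ⋆≈▷ : ∀ r s → r ⋆ s C.≈ᴹ r L.▷ s
    ⋆≈▷ r s x = ≡.sym (sum-at G.setoid {order} _ x)

    ▷≈⋆ : ∀ r s → r L.▷ s C.≈ᴹ r ⋆ s
    ▷≈⋆ r s = C.≈ᴹ-sym {r ⋆ s} {r L.▷ s} (⋆≈▷ r s)

    ⋆-identityʳ : ∀ r → r ⋆ δ ε C.≈ᴹ r
    ⋆-identityʳ r x = begin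
      ℤ-sum (λ k → to r (elt k) ℤ.* to (δ ε) (elt k ⁻¹ ∙ x))
        ≡⟨ ModuleSum.sum-single ℤ¹ {order} _ (index x) off ⟩
      to r (elt (index x)) ℤ.* to (δ ε) (elt (index x) ⁻¹ ∙ x)
        ≡⟨ cong₂ ℤ._*_ (Func.cong r (G.elt-index x))
             (δ-yes (G.trans (G.∙-congʳ (G.⁻¹-cong (G.elt-index x))) (G.inverseˡ x))) ⟩
      to r x ℤ.* 1ℤ
        ≡⟨ ℤ.*-identityʳ _ ⟩
      to r x ∎
      where
      open ≡.≡-Reasoning
      open GroupProperties G.group using (⁻¹-injective; inverseˡ-unique)
      off : ∀ k → k ≢ index x → to r (elt k) ℤ.* to (δ ε) (elt k ⁻¹ ∙ x) ≡ 0ℤ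
      off k k≢ = ≡.trans
        (cong (to r (elt k) ℤ.*_) (δ-no λ e → k≢ (≡.trans (≡.sym (G.index-elt k))
          (Inverse.from-cong G.enum (⁻¹-injective (inverseˡ-unique _ _ e))))))
        (ℤ.*-zeroʳ (to r (elt k)))

  ℤ[G] : Ring 0ℓ 0ℓ
  ℤ[G] = record
    { Carrier = Element
    ; _≈_ = C._≈ᴹ_
    ; _+_ = C._+ᴹ_
    ; _*_ = _⋆_
    ; -_ = C.-ᴹ_
    ; 0# = C.0ᴹ
    ; 1# = δ ε
    ; isRing = record
      { +-isAbelianGroup = C.+ᴹ-isAbelianGroup
      ; *-cong = λ {r} {r′} {s} {s′} e e′ x → ≡.trans (⋆≈▷ r s x)
          (≡.trans (L.▷-cong {r} {r′} {s} {s′} e e′ x) (▷≈⋆ r′ s′ x))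
      ; *-assoc = λ r s t x → ≡.trans (⋆≈▷ (r ⋆ s) t x) (≡.trans (L.▷-assoc r s t x)
          (≡.trans (L.▷-cong {r} {r} {s L.▷ t} {s ⋆ t} (λ _ → ≡.refl) (▷≈⋆ s t) x)
                   (▷≈⋆ r (s ⋆ t) x)))
      ; *-identity = (λ r x → ≡.trans (⋆≈▷ (δ ε) r x) (L.▷-identityˡ r x)) , ⋆-identityʳ
      ; distrib =
          (λ r s t x → ≡.trans (⋆≈▷ r (s C.+ᴹ t) x) (≡.trans (L.▷-distribˡ r s t x)
            (cong₂ ℤ._+_ (▷≈⋆ r s x) (▷≈⋆ r t x)))) ,
          (λ t r s x → ≡.trans (⋆≈▷ (r C.+ᴹ s) t x) (≡.trans (L.▷-distribʳ t r s x)
            (cong₂ ℤ._+_ (▷≈⋆ r t x) (▷≈⋆ s t x))))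
      }
    }

  module _ (V : Representation G) where
    open Representation V
    open Extend V
    open ModuleSum space
    open ≈-Reasoning ≈ᴹ-setoid

    extend : LeftModule ℤ[G] 0ℓ 0ℓ
    extend = record
      { _*ₗ_ = _▷_
      ; -ᴹ_ = -ᴹ_
      ; isLeftModule = record
        { isLeftSemimodule = record
          { +ᴹ-isCommutativeMonoid = +ᴹ-isCommutativeMonoid
          ; isPreleftSemimodule = record
            { *ₗ-cong = λ {r} {s} → ▷-cong {r} {s}
            ; *ₗ-zeroˡ = ▷-zeroˡ
            ; *ₗ-distribʳ = ▷-distribʳ
            ; *ₗ-identityˡ = ▷-identityˡ
            ; *ₗ-assoc = ▷-assoc
            ; *ₗ-zeroʳ = ▷-zeroʳ
            ; *ₗ-distribˡ = ▷-distribˡ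
            }
          }
        ; -ᴹ‿cong = -ᴹ‿cong
        ; -ᴹ‿inverse = -ᴹ‿inverse
        }
      }

    extend-finitelyGenerated : FinitelyGenerated space → FinitelyGenerated extend
    extend-finitelyGenerated (k , g , span) = k , g , λ m →
      (λ i → proj₁ (span m) i C.*ₗ δ ε) ,
      ≈ᴹ-trans (proj₂ (span m)) (sum-cong-≋ {k} λ i → ≈ᴹ-sym (scalar (proj₁ (span m) i) (g i)))
      where
      scalar : ∀ a m → (a C.*ₗ δ ε) ▷ m ≈ᴹ a *ₗ m
      scalar a m = begin
        (a C.*ₗ δ ε) ▷ m                                   ≈⟨ sum-cong-≋ {order} (λ k → *ₗ-assoc _ _ _) ⟩
        sum (λ k → a *ₗ (to (δ ε) (elt k) *ₗ elt k · m))   ≈⟨ *ₗ-sum {order} _ _ ⟨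
        a *ₗ (δ ε ▷ m)                                     ≈⟨ *ₗ-congˡ (▷-identityˡ m) ⟩
        a *ₗ m                                             ∎

record Lattice (G : FiniteGroup) : Set₁ where
  field
    asModule          : LeftModule (GroupRing.ℤ[G] G) 0ℓ 0ℓ
    finitelyGenerated : FinitelyGenerated asModule
    torsionFree       : TorsionFree asModule

module _ {G : FiniteGroup} where

  infixr 6 _⊕_
  infix 4 _≅_

  _⊕_ : Lattice G → Lattice G → Lattice G
  A ⊕ B = record
    { asModule = AB
    ; finitelyGenerated = fg A.finitelyGenerated B.finitelyGenerated
    ; torsionFree = λ k m e →
        A.torsionFree k (proj₁ m) (A′.≈ᴹ-trans (A′.≈ᴹ-sym (fst k m)) (proj₁ e)) ,
        B.torsionFree k (proj₂ m) (B′.≈ᴹ-trans (B′.≈ᴹ-sym (snd k m)) (proj₂ e))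
    }
    where
    module A = Lattice A
    module B = Lattice B
    module A′ = LeftModule A.asModule
    module B′ = LeftModule B.asModule
    AB = DirectProduct.leftModule A.asModule B.asModule
    open LeftModule AB
    module R = Ring (GroupRing.ℤ[G] G)
    module ΣA = ModuleSum A.asModule
    module ΣB = ModuleSum B.asModule
    open ModuleSum AB
    module ×A = RawMonoidDefinitions A′.+ᴹ-rawMonoid
    module ×B = RawMonoidDefinitions B′.+ᴹ-rawMonoid
    module ×AB = RawMonoidDefinitions +ᴹ-rawMonoid

    fst : ∀ k m → proj₁ (k ×AB.× m) A′.≈ᴹ k ×A.× proj₁ m
    fst zero    m = A′.≈ᴹ-refl
    fst (suc k) m = A′.+ᴹ-congˡ (fst k m)

    snd : ∀ k m → proj₂ (k ×AB.× m) B′.≈ᴹ k ×B.× proj₂ m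
    snd zero    m = B′.≈ᴹ-refl
    snd (suc k) m = B′.+ᴹ-congˡ (snd k m)

    sum-pair : ∀ {n} (t : Vector Carrierᴹ n) →
               sum t ≈ᴹ (ΣA.sum (proj₁ ∘ t) , ΣB.sum (proj₂ ∘ t))
    sum-pair {zero}  t = A′.≈ᴹ-refl , B′.≈ᴹ-refl
    sum-pair {suc n} t = A′.+ᴹ-congˡ (proj₁ (sum-pair (t ∘ suc))) ,
                         B′.+ᴹ-congˡ (proj₂ (sum-pair (t ∘ suc)))

    fg : FinitelyGenerated A.asModule → FinitelyGenerated B.asModule → FinitelyGenerated AB
    fg (k , g , spanA) (l , h , spanB) = k ℕ.+ l , gens , λ m → coeffs m , ≈ᴹ-sym (recover m)
      where
      gA : Vector Carrierᴹ k
      gA i = g i , B′.0ᴹ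
      gB : Vector Carrierᴹ l
      gB j = A′.0ᴹ , h j
      gens : Vector Carrierᴹ (k ℕ.+ l)
      gens = gA ++ gB
      cA = λ m → proj₁ (spanA (proj₁ m))
      cB = λ m → proj₁ (spanB (proj₂ m))
      coeffs : Carrierᴹ → Vector R.Carrier (k ℕ.+ l)
      coeffs m = cA m ++ cB m
      termwise : ∀ m i → coeffs m i *ₗ gens i ≈ᴹ
                 ((λ j → cA m j *ₗ gA j) ++ (λ j → cB m j *ₗ gB j)) i
      termwise m i with splitAt k i
      ... | inj₁ j = ≈ᴹ-refl
      ... | inj₂ j = ≈ᴹ-refl
      recover : ∀ m → sum (λ i → coeffs m i *ₗ gens i) ≈ᴹ m
      recover m = begin
        sum (λ i → coeffs m i *ₗ gens i)
          ≈⟨ sum-cong-≋ {k ℕ.+ l} (termwise m) ⟩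
        sum ((λ j → cA m j *ₗ gA j) ++ (λ j → cB m j *ₗ gB j))
          ≈⟨ sum-++ {k} {l} _ _ ⟩
        sum (λ j → cA m j *ₗ gA j) +ᴹ sum (λ j → cB m j *ₗ gB j)
          ≈⟨ +ᴹ-cong (sum-pair {k} _) (sum-pair {l} _) ⟩
        _ ≈⟨ A′.+ᴹ-cong (A′.≈ᴹ-sym (proj₂ (spanA (proj₁ m)))) (ΣA.sum-zero {l} _ (λ j → A′.*ₗ-zeroʳ (cB m j))) ,
             B′.+ᴹ-cong (ΣB.sum-zero {k} _ (λ j → B′.*ₗ-zeroʳ (cA m j))) (B′.≈ᴹ-sym (proj₂ (spanB (proj₂ m)))) ⟩
        (proj₁ m A′.+ᴹ A′.0ᴹ , B′.0ᴹ B′.+ᴹ proj₂ m)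
          ≈⟨ A′.+ᴹ-identityʳ _ , B′.+ᴹ-identityˡ _ ⟩
        m ∎
        where open ≈-Reasoning ≈ᴹ-setoid

  record _≅_ (A B : Lattice G) : Set where
    private
      module A = LeftModule (Lattice.asModule A)
      module B = LeftModule (Lattice.asModule B)
    open LeftModuleMorphisms A.rawLeftModule B.rawLeftModule
    field
      to            : A.Carrierᴹ → B.Carrierᴹ
      isIsomorphism : IsLeftModuleIsomorphism to

module _ (G : FiniteGroup) where
  private module G = FiniteGroup G
  open GroupRing G

  ℤ[_] : Lattice G
  ℤ[_] = record
    { asModule = TensorUnit.leftModule {R = ℤ[G]}
    ; finitelyGenerated = 1 , (λ _ → 1#) , λ r → (λ _ → r) ,
        sym {r * 1# + 0#} {r} (trans {r * 1# + 0#} {r * 1#} {r} (+-identityʳ (r * 1#)) (*-identityʳ r))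
    ; torsionFree = ℤ^-torsionFree G.setoid
    }
    where open Ring ℤ[G]

  ℤ[_/_] : Subgroup G → Lattice G
  ℤ[_/_] S = record
    { asModule = extend V
    ; finitelyGenerated = extend-finitelyGenerated V
        (Delta.finitelyGenerated G/S.setoid G/S._≟_ G/S.point G/S.covers)
    ; torsionFree = ℤ^-torsionFree G/S.setoid
    }
    where
    module G/S = FiniteGSet (leftCosets G S)
    V = permutation (leftCosets G S)

  ℤ-trivial : Lattice G
  ℤ-trivial = record
    { asModule = extend V
    ; finitelyGenerated = extend-finitelyGenerated V ℤ¹-finitelyGenerated
    ; torsionFree = ℤ¹-torsionFree
    }
    where
    V : Representation G
    V = record
      { space = ℤ¹
      ; _·_ = λ _ a → a
      ; ·-cong = λ _ e → e
      ; ·-+ᴹ = λ _ _ _ → ≡.refl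
      ; ·-*ₗ = λ _ _ _ → ≡.refl
      ; ·-identity = λ _ → ≡.refl
      ; ·-assoc = λ _ _ _ → ≡.refl
      }

module Cyclic (n : ℕ) .{{_ : NonZero n}} where

  infixl 6 _+ₙ_
  infix 8 -ₙ_

  _+ₙ_ : Fin n → Fin n → Fin n
  i +ₙ j = (toℕ i ℕ.+ toℕ j) mod n

  -ₙ_ : Fin n → Fin n
  -ₙ i = (n ℕ.∸ toℕ i) mod n

  0ₙ 1ₙ : Fin n
  0ₙ = 0 mod n
  1ₙ = 1 mod n

  toℕ-mod : ∀ k → toℕ (k mod n) ≡ k % n
  toℕ-mod k = Fin.toℕ-fromℕ< (ℕ.m%n<n k n)

  mod-cong : ∀ {k l} → k % n ≡ l % n → k mod n ≡ l mod n
  mod-cong {k} {l} e = Fin.toℕ-injective (≡.trans (toℕ-mod k) (≡.trans e (≡.sym (toℕ-mod l))))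

  mod-toℕ : ∀ i → toℕ i mod n ≡ i
  mod-toℕ i = Fin.toℕ-injective (≡.trans (toℕ-mod (toℕ i)) (ℕ.m<n⇒m%n≡m (Fin.toℕ<n i)))

  %-+ˡ : ∀ k l → (k % n ℕ.+ l) % n ≡ (k ℕ.+ l) % n
  %-+ˡ k l = begin
    (k % n ℕ.+ l) % n          ≡⟨ ℕ.%-distribˡ-+ (k % n) l n ⟩
    (k % n % n ℕ.+ l % n) % n  ≡⟨ cong (λ z → (z ℕ.+ l % n) % n) (ℕ.m%n%n≡m%n k n) ⟩
    (k % n ℕ.+ l % n) % n      ≡⟨ ℕ.%-distribˡ-+ k l n ⟨
    (k ℕ.+ l) % n              ∎
    where open ≡.≡-Reasoning

  mod-+ˡ : ∀ k j → (k mod n) +ₙ j ≡ (k ℕ.+ toℕ j) mod n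
  mod-+ˡ k j = mod-cong (≡.trans (cong (λ z → (z ℕ.+ toℕ j) % n) (toℕ-mod k)) (%-+ˡ k (toℕ j)))

  +ₙ-comm : ∀ i j → i +ₙ j ≡ j +ₙ i
  +ₙ-comm i j = cong (_mod n) (ℕ.+-comm (toℕ i) (toℕ j))

  +ₙ-assoc : ∀ i j k → (i +ₙ j) +ₙ k ≡ i +ₙ (j +ₙ k)
  +ₙ-assoc i j k = begin
    (i +ₙ j) +ₙ k                            ≡⟨ mod-+ˡ (toℕ i ℕ.+ toℕ j) k ⟩
    (toℕ i ℕ.+ toℕ j ℕ.+ toℕ k) mod n
      ≡⟨ cong (_mod n) (≡.trans (ℕ.+-assoc (toℕ i) _ _) (ℕ.+-comm (toℕ i) _)) ⟩
    (toℕ j ℕ.+ toℕ k ℕ.+ toℕ i) mod n        ≡⟨ mod-+ˡ (toℕ j ℕ.+ toℕ k) i ⟨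
    (j +ₙ k) +ₙ i                            ≡⟨ +ₙ-comm (j +ₙ k) i ⟩
    i +ₙ (j +ₙ k)                            ∎
    where open ≡.≡-Reasoning

  +ₙ-identityˡ : ∀ i → 0ₙ +ₙ i ≡ i
  +ₙ-identityˡ i = ≡.trans (mod-+ˡ 0 i) (mod-toℕ i)

  +ₙ-inverseˡ : ∀ i → -ₙ i +ₙ i ≡ 0ₙ
  +ₙ-inverseˡ i = ≡.trans (mod-+ˡ (n ℕ.∸ toℕ i) i) (mod-cong (≡.trans
    (cong (_% n) (ℕ.m∸n+n≡m (ℕ.<⇒≤ (Fin.toℕ<n i))))
    (ℕ.[m+n]%n≡m%n 0 n)))

  ℤ/n : AbelianGroup 0ℓ 0ℓ
  ℤ/n = record
    { Carrier = Fin n ; _≈_ = _≡_ ; _∙_ = _+ₙ_ ; ε = 0ₙ ; _⁻¹ = -ₙ_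
    ; isAbelianGroup = record
      { isGroup = record
        { isMonoid = record
          { isSemigroup = record
            { isMagma = ≡.isMagma _+ₙ_ ; assoc = +ₙ-assoc }
          ; identity = +ₙ-identityˡ , λ i → ≡.trans (+ₙ-comm i 0ₙ) (+ₙ-identityˡ i)
          }
        ; inverse = +ₙ-inverseˡ , λ i → ≡.trans (+ₙ-comm i (-ₙ i)) (+ₙ-inverseˡ i)
        ; ⁻¹-cong = cong -ₙ_
        }
      ; comm = +ₙ-comm
      }
    }

  open AbelianGroup ℤ/n public
    using () renaming (identityʳ to +ₙ-identityʳ; inverseʳ to +ₙ-inverseʳ)
  open AbelianGroupProperties ℤ/n public
    using () renaming (⁻¹-involutive to -ₙ-involutive; ⁻¹-∙-comm to -ₙ-distrib; ε⁻¹≈ε to -ₙ0≡0)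

module Dihedral (n : ℕ) .{{_ : NonZero n}} where
  open Cyclic n public

  -- (i , e) stands for σⁱτᵉ.
  Dₙ-Carrier : Set
  Dₙ-Carrier = Fin n × Parity

  -- σʲ ↦ τᵉσʲτ⁻ᵉ
  _▹_ : Parity → Fin n → Fin n
  0ℙ ▹ j = j
  1ℙ ▹ j = -ₙ j

  ▹-+ : ∀ e i j → e ▹ (i +ₙ j) ≡ (e ▹ i) +ₙ (e ▹ j)
  ▹-+ 0ℙ i j = ≡.refl
  ▹-+ 1ℙ i j = ≡.sym (-ₙ-distrib i j)

  ▹-▹ : ∀ e p j → e ▹ (p ▹ j) ≡ (e ℙ.+ p) ▹ j
  ▹-▹ 0ℙ p  j = ≡.refl
  ▹-▹ 1ℙ 0ℙ j = ≡.refl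
  ▹-▹ 1ℙ 1ℙ j = -ₙ-involutive j

  ▹-0 : ∀ e → e ▹ 0ₙ ≡ 0ₙ
  ▹-0 0ℙ = ≡.refl
  ▹-0 1ℙ = -ₙ0≡0

  infixl 7 _∙ᴰ_

  _∙ᴰ_ : Dₙ-Carrier → Dₙ-Carrier → Dₙ-Carrier
  (i , e) ∙ᴰ (j , p) = (i +ₙ (e ▹ j)) , (e ℙ.+ p)

  _⁻¹ᴰ : Dₙ-Carrier → Dₙ-Carrier
  (i , e) ⁻¹ᴰ = -ₙ (e ▹ i) , e

  ∙ᴰ-assoc : ∀ x y z → (x ∙ᴰ y) ∙ᴰ z ≡ x ∙ᴰ (y ∙ᴰ z)
  ∙ᴰ-assoc (i , e) (j , p) (k , q) = cong₂ _,_
    (≡.trans (+ₙ-assoc i (e ▹ j) _) (cong (i +ₙ_) (≡.sym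
      (≡.trans (▹-+ e j (p ▹ k)) (cong ((e ▹ j) +ₙ_) (▹-▹ e p k))))))
    (ℙ.+-assoc e p q)

  ∙ᴰ-inverseˡ : ∀ x → (x ⁻¹ᴰ) ∙ᴰ x ≡ (0ₙ , 0ℙ)
  ∙ᴰ-inverseˡ (i , e) = cong₂ _,_ (+ₙ-inverseˡ (e ▹ i)) (ℙ.p+p≡0ℙ e)

  ∙ᴰ-inverseʳ : ∀ x → x ∙ᴰ (x ⁻¹ᴰ) ≡ (0ₙ , 0ℙ)
  ∙ᴰ-inverseʳ (i , 0ℙ) = cong (_, 0ℙ) (+ₙ-inverseʳ i)
  ∙ᴰ-inverseʳ (i , 1ℙ) = cong (_, 0ℙ)
    (≡.trans (cong (λ z → i +ₙ -ₙ z) (-ₙ-involutive i)) (+ₙ-inverseʳ i))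

  D-group : Group 0ℓ 0ℓ
  D-group = record
    { Carrier = Dₙ-Carrier ; _≈_ = _≡_ ; _∙_ = _∙ᴰ_ ; ε = 0ₙ , 0ℙ ; _⁻¹ = _⁻¹ᴰ
    ; isGroup = record
      { isMonoid = record
        { isSemigroup = record { isMagma = ≡.isMagma _∙ᴰ_ ; assoc = ∙ᴰ-assoc }
        ; identity = (λ (i , e) → cong (_, e) (+ₙ-identityˡ i))
                   , (λ (i , e) → cong₂ _,_ (≡.trans (cong (i +ₙ_) (▹-0 e)) (+ₙ-identityʳ i))
                                            (ℙ.+-identityʳ e))
        }
      ; inverse = ∙ᴰ-inverseˡ , ∙ᴰ-inverseʳ
      ; ⁻¹-cong = cong _⁻¹ᴰ
      }
    }

  D : FiniteGroup
  D = record
    { group = D-group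
    ; order = n ℕ.* 2
    ; enum  = ×-parity ↔-∘ Fin.*↔×
    }
    where
    parity : Fin 2 → Parity
    parity zero       = 0ℙ
    parity (suc zero) = 1ℙ
    unparity : Parity → Fin 2
    unparity 0ℙ = zero
    unparity 1ℙ = suc zero
    ×-parity = mk↔ₛ′ {A = Fin n × Fin 2} {B = Dₙ-Carrier}
      (λ (i , b) → i , parity b) (λ (i , e) → i , unparity e)
      (λ { (i , 0ℙ) → ≡.refl ; (i , 1ℙ) → ≡.refl })
      (λ { (i , zero) → ≡.refl ; (i , suc zero) → ≡.refl })

  σ τ : Dₙ-Carrier
  σ = 1ₙ , 0ℙ
  τ = 0ₙ , 1ℙ

  record Relations (H : Group 0ℓ 0ℓ) (s t : Group.Carrier H) : Set where
    open Group H
    open RawMonoidDefinitions rawMonoid using () renaming (_×_ to _times_)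
    field
      sⁿ≈ε     : n times s ≈ ε
      t²≈ε     : 2 times t ≈ ε
      tst⁻¹≈s⁻¹ : (t ∙ s) ∙ t ⁻¹ ≈ s ⁻¹

  private
    module D-Mult = RawMonoidDefinitions (Group.rawMonoid D-group)

    σ-times : ∀ k → k D-Mult.× σ ≡ (k mod n , 0ℙ)
    σ-times zero    = ≡.refl
    σ-times (suc k) = ≡.trans (cong (σ ∙ᴰ_) (σ-times k)) (cong (_, 0ℙ)
      (≡.trans (+ₙ-comm 1ₙ (k mod n)) (≡.trans (mod-+ˡ k 1ₙ)
        (≡.trans (cong (_mod n) (ℕ.+-comm k (toℕ 1ₙ)))
          (mod-cong (≡.trans (cong (λ z → (z ℕ.+ k) % n) (toℕ-mod 1)) (%-+ˡ 1 k)))))))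

  D-relations : Relations D-group σ τ
  D-relations = record
    { sⁿ≈ε = ≡.trans (σ-times n) (cong (_, 0ℙ) (mod-cong (ℕ.[m+n]%n≡m%n 0 n)))
    ; t²≈ε = cong (_, 0ℙ) (≡.trans (+ₙ-identityˡ _)
        (≡.trans (cong -ₙ_ (≡.trans (+ₙ-identityˡ _) -ₙ0≡0)) -ₙ0≡0))
    ; tst⁻¹≈s⁻¹ = cong (_, 0ℙ) (≡.trans (cong ((0ₙ +ₙ -ₙ 1ₙ) +ₙ_)
        (≡.trans (-ₙ-involutive (-ₙ 0ₙ)) -ₙ0≡0)) (≡.trans (+ₙ-identityʳ _) (+ₙ-identityˡ _)))
    }

  τ^ : Parity → Dₙ-Carrier
  τ^ 0ℙ = Group.ε D-group
  τ^ 1ℙ = τ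

  D-normalForm : ∀ i e → (i , e) ≡ (toℕ i D-Mult.× σ) ∙ᴰ τ^ e
  D-normalForm i e = ≡.sym (≡.trans (cong (_∙ᴰ τ^ e) (σ-times (toℕ i)))
    (≡.trans (split e) (cong (_, e) (mod-toℕ i))))
    where
    split : ∀ e → (toℕ i mod n , 0ℙ) ∙ᴰ τ^ e ≡ (toℕ i mod n , e)
    split 0ℙ = cong (_, 0ℙ) (+ₙ-identityʳ _)
    split 1ℙ = cong (_, 1ℙ) (+ₙ-identityʳ _)

  -- Together with D-normalForm (σ and τ generate), this says that D is
  -- the group presented by the generators σ, τ and the above relations.
  D-universal : ∀ (H : Group 0ℓ 0ℓ) s t → Relations H s t →
                Σ[ φ ∈ (Dₙ-Carrier → Group.Carrier H) ]
                GroupMorphisms.IsGroupHomomorphism (Group.rawGroup D-group) (Group.rawGroup H) φ × Group._≈_ H (φ σ) s × Group._≈_ H (φ τ) t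
  D-universal H s t rels = φ , isHom , φσ , φτ
    where
    open Group H
    open Relations rels
    open GroupProperties H
    open Mult monoid using (×-homo-+; ×-assocˡ; ×-congʳ; ×-congˡ) renaming (_×_ to _times_)
    open ≈-Reasoning setoid

    P : ℕ → Carrier
    P k = k times s

    T : Parity → Carrier
    T 0ℙ = ε
    T 1ℙ = t

    φ : Dₙ-Carrier → Carrier
    φ (i , e) = P (toℕ i) ∙ T e

    times-ε : ∀ k → k times ε ≈ ε
    times-ε zero    = refl
    times-ε (suc k) = trans (identityˡ _) (times-ε k)

    P-% : ∀ k → P (k % n) ≈ P k
    P-% k = begin
      P (k % n)                            ≈⟨ identityʳ _ ⟨
      P (k % n) ∙ ε                        ≈⟨ ∙-congˡ (times-ε (k ℕ./ n)) ⟨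
      P (k % n) ∙ ((k ℕ./ n) times ε)      ≈⟨ ∙-congˡ (×-congʳ (k ℕ./ n) sⁿ≈ε) ⟨
      P (k % n) ∙ ((k ℕ./ n) times P n)    ≈⟨ ∙-congˡ (×-assocˡ s (k ℕ./ n) n) ⟩
      P (k % n) ∙ P ((k ℕ./ n) ℕ.* n)      ≈⟨ ×-homo-+ s (k % n) _ ⟨
      P (k % n ℕ.+ (k ℕ./ n) ℕ.* n)        ≡⟨ cong P (ℕ.m≡m%n+[m/n]*n k n) ⟨
      P k                                  ∎

    P-mod : ∀ k → P (toℕ (k mod n)) ≈ P k
    P-mod k = trans (reflexive (cong P (toℕ-mod k))) (P-% k)

    P-neg : ∀ i → P (toℕ (-ₙ i)) ≈ P (toℕ i) ⁻¹
    P-neg i = trans (P-mod (n ℕ.∸ toℕ i)) (inverseˡ-unique _ _ (begin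
      P (n ℕ.∸ toℕ i) ∙ P (toℕ i)   ≈⟨ ×-homo-+ s (n ℕ.∸ toℕ i) (toℕ i) ⟨
      P (n ℕ.∸ toℕ i ℕ.+ toℕ i)     ≡⟨ cong P (ℕ.m∸n+n≡m (ℕ.<⇒≤ (Fin.toℕ<n i))) ⟩
      P n                           ≈⟨ sⁿ≈ε ⟩
      ε                             ∎))

    tt≈ε : t ∙ t ≈ ε
    tt≈ε = trans (∙-congˡ (sym (identityʳ t))) t²≈ε

    ts : t ∙ s ≈ s ⁻¹ ∙ t
    ts = begin
      t ∙ s                  ≈⟨ identityʳ _ ⟨
      t ∙ s ∙ ε              ≈⟨ ∙-congˡ (inverseˡ t) ⟨
      t ∙ s ∙ (t ⁻¹ ∙ t)     ≈⟨ assoc _ _ _ ⟨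
      t ∙ s ∙ t ⁻¹ ∙ t       ≈⟨ ∙-congʳ tst⁻¹≈s⁻¹ ⟩
      s ⁻¹ ∙ t               ∎

    P-suc : ∀ k → P (suc k) ≈ P k ∙ s
    P-suc k = begin
      P (suc k)          ≡⟨ cong P (ℕ.+-comm 1 k) ⟩
      P (k ℕ.+ 1)        ≈⟨ ×-homo-+ s k 1 ⟩
      P k ∙ (s ∙ ε)      ≈⟨ ∙-congˡ (identityʳ s) ⟩
      P k ∙ s            ∎

    tP : ∀ k → t ∙ P k ≈ P k ⁻¹ ∙ t
    tP zero    = trans (identityʳ t) (sym (trans (∙-congʳ ε⁻¹≈ε) (identityˡ t)))
    tP (suc k) = begin
      t ∙ (s ∙ P k)           ≈⟨ assoc _ _ _ ⟨
      t ∙ s ∙ P k             ≈⟨ ∙-congʳ ts ⟩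
      s ⁻¹ ∙ t ∙ P k          ≈⟨ assoc _ _ _ ⟩
      s ⁻¹ ∙ (t ∙ P k)        ≈⟨ ∙-congˡ (tP k) ⟩
      s ⁻¹ ∙ (P k ⁻¹ ∙ t)     ≈⟨ assoc _ _ _ ⟨
      s ⁻¹ ∙ P k ⁻¹ ∙ t       ≈⟨ ∙-congʳ (⁻¹-anti-homo-∙ (P k) s) ⟨
      (P k ∙ s) ⁻¹ ∙ t        ≈⟨ ∙-congʳ (⁻¹-cong (P-suc k)) ⟨
      P (suc k) ⁻¹ ∙ t        ∎

    T-+ : ∀ e p → T (e ℙ.+ p) ≈ T e ∙ T p
    T-+ 0ℙ p  = sym (identityˡ _)
    T-+ 1ℙ 0ℙ = sym (identityʳ _)
    T-+ 1ℙ 1ℙ = sym tt≈ε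

    TP : ∀ e j → T e ∙ P (toℕ j) ≈ P (toℕ (e ▹ j)) ∙ T e
    TP 0ℙ j = trans (identityˡ _) (sym (identityʳ _))
    TP 1ℙ j = trans (tP (toℕ j)) (∙-congʳ (sym (P-neg j)))

    φ-homo : ∀ x y → φ (x ∙ᴰ y) ≈ φ x ∙ φ y
    φ-homo (i , e) (j , p) = begin
      P (toℕ (i +ₙ (e ▹ j))) ∙ T (e ℙ.+ p)
        ≈⟨ ∙-cong (trans (P-mod (toℕ i ℕ.+ toℕ (e ▹ j))) (×-homo-+ s (toℕ i) _)) (T-+ e p) ⟩
      P (toℕ i) ∙ P (toℕ (e ▹ j)) ∙ (T e ∙ T p)     ≈⟨ assoc _ _ _ ⟨
      P (toℕ i) ∙ P (toℕ (e ▹ j)) ∙ T e ∙ T p       ≈⟨ ∙-congʳ (assoc _ _ _) ⟩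
      P (toℕ i) ∙ (P (toℕ (e ▹ j)) ∙ T e) ∙ T p     ≈⟨ ∙-congʳ (∙-congˡ (TP e j)) ⟨
      P (toℕ i) ∙ (T e ∙ P (toℕ j)) ∙ T p           ≈⟨ ∙-congʳ (assoc _ _ _) ⟨
      P (toℕ i) ∙ T e ∙ P (toℕ j) ∙ T p             ≈⟨ assoc _ _ _ ⟩
      φ (i , e) ∙ φ (j , p)                         ∎

    φ-ε : φ (0ₙ , 0ℙ) ≈ ε
    φ-ε = trans (identityʳ _) (P-mod 0)

    isHom : GroupMorphisms.IsGroupHomomorphism (Group.rawGroup D-group) (Group.rawGroup H) φ
    isHom = record
      { isMonoidHomomorphism = record
        { isMagmaHomomorphism = record
          { isRelHomomorphism = record { cong = λ { ≡.refl → refl } } ; homo = φ-homo }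
        ; ε-homo = φ-ε
        }
      ; ⁻¹-homo = λ x → inverseˡ-unique _ _ (trans (sym (φ-homo (x ⁻¹ᴰ) x))
          (trans (reflexive (cong φ (∙ᴰ-inverseˡ x))) φ-ε))
      }

    φσ : φ σ ≈ s
    φσ = trans (identityʳ _) (trans (P-mod 1) (identityʳ s))

    φτ : φ τ ≈ t
    φτ = trans (∙-congʳ (P-mod 0)) (identityˡ t)

  private
    inSpan : ∀ e → Generated D τ (0ₙ , e)
    inSpan 0ℙ = unit
    inSpan 1ℙ = gen

    first≡0 : ∀ {x} → Generated D τ x → proj₁ x ≡ 0ₙ
    first≡0 gen = ≡.refl
    first≡0 unit = ≡.refl
    first≡0 (mul {i , e} {j , p} x y) rewrite first≡0 x | first≡0 y =
      ≡.trans (+ₙ-identityˡ _) (▹-0 e)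
    first≡0 (inv {i , e} x) rewrite first≡0 x = ≡.trans (cong -ₙ_ (▹-0 e)) -ₙ0≡0
    first≡0 (resp ≡.refl x) = first≡0 x

  ⟨τ⟩ : Subgroup D
  ⟨τ⟩ = ⟨_⟩by_ D τ λ (i , e) →
    map′ (λ { ≡.refl → inSpan e }) first≡0 (i Fin.≟ 0ₙ)

module _ (n : ℕ) .{{_ : NonZero n}} where
  open Dihedral n
  open GroupRing D using (extend; extend-finitelyGenerated)
  private module R = GroupRing D

  data Basis : Set where
    w  : Fin n → Basis
    w′ : Basis

  private
    w-injective : ∀ {i j} → w i ≡ w j → i ≡ j
    w-injective ≡.refl = ≡.refl

    _≟ᴮ_ : ∀ (a b : Basis) → Dec (a ≡ b)
    w i ≟ᴮ w j = map′ (cong w) w-injective (i Fin.≟ j)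
    w i ≟ᴮ w′  = no λ ()
    w′  ≟ᴮ w j = no λ ()
    w′  ≟ᴮ w′  = yes ≡.refl

    point : Fin (suc n) → Basis
    point zero    = w′
    point (suc i) = w i

    covers : ∀ b → ∃[ k ] point k ≡ b
    covers (w i) = suc i , ≡.refl
    covers w′    = zero , ≡.refl

    module E = Delta (≡.setoid Basis) _≟ᴮ_

  -- The coordinates of σⁱ·v and τᵉ·v in terms of those of v, with respect
  -- to the basis w₀,…,wₙ₋₁,w′. Since τ·wᵢ = -w₋ᵢ and τ·w′ = w′ - Σᵢ wᵢ, the
  -- coefficient of wₖ in τ·v is -v(w₋ₖ) - v(w′). The module M̃₋-basis below
  -- checks the resulting ℤ[D]-module against the values on the basis.
  rotate : Fin n → (Basis → ℤ) → Basis → ℤ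
  rotate i v (w k) = v (w (k +ₙ -ₙ i))
  rotate i v w′    = v w′

  reflect : Parity → (Basis → ℤ) → Basis → ℤ
  reflect 0ℙ v b     = v b
  reflect 1ℙ v (w k) = ℤ.- v (w (-ₙ k)) ℤ.- v w′
  reflect 1ℙ v w′    = v w′

  private
    cancel : ∀ a c → ℤ.- (ℤ.- a ℤ.- c) ℤ.- c ≡ a
    cancel = solve-∀

    neg-+ : ∀ a b c d → ℤ.- (a ℤ.+ b) ℤ.- (c ℤ.+ d) ≡ (ℤ.- a ℤ.- c) ℤ.+ (ℤ.- b ℤ.- d)
    neg-+ = solve-∀

    neg-* : ∀ a b c → ℤ.- (a ℤ.* b) ℤ.- (a ℤ.* c) ≡ a ℤ.* (ℤ.- b ℤ.- c)
    neg-* = solve-∀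

    rotate-cong : ∀ i {u v : Basis → ℤ} → (∀ b → u b ≡ v b) → ∀ b → rotate i u b ≡ rotate i v b
    rotate-cong i e (w k) = e _
    rotate-cong i e w′    = e w′

    reflect-cong : ∀ p {u v : Basis → ℤ} → (∀ b → u b ≡ v b) → ∀ b → reflect p u b ≡ reflect p v b
    reflect-cong 0ℙ e b     = e b
    reflect-cong 1ℙ e (w k) = cong₂ (λ a c → ℤ.- a ℤ.- c) (e _) (e w′)
    reflect-cong 1ℙ e w′    = e w′

    rotate-rotate : ∀ i j v b → rotate (i +ₙ j) v b ≡ rotate i (rotate j v) b
    rotate-rotate i j v w′    = ≡.refl
    rotate-rotate i j v (w k) = cong (v ∘ w) (≡.trans
      (cong (k +ₙ_) (≡.sym (-ₙ-distrib i j))) (≡.sym (+ₙ-assoc k (-ₙ i) (-ₙ j))))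

    reflect-reflect : ∀ e p v b → reflect (e ℙ.+ p) v b ≡ reflect e (reflect p v) b
    reflect-reflect 0ℙ p  v b     = ≡.refl
    reflect-reflect 1ℙ 0ℙ v b     = ≡.refl
    reflect-reflect 1ℙ 1ℙ v w′    = ≡.refl
    reflect-reflect 1ℙ 1ℙ v (w k) = ≡.sym (≡.trans (cancel _ (v w′))
      (cong (v ∘ w) (-ₙ-involutive k)))

    reflect-rotate : ∀ e j v b → rotate (e ▹ j) (reflect e v) b ≡ reflect e (rotate j v) b
    reflect-rotate 0ℙ j v b     = ≡.refl
    reflect-rotate 1ℙ j v w′    = ≡.refl
    reflect-rotate 1ℙ j v (w k) = cong (λ i → ℤ.- v (w i) ℤ.- v w′) (≡.trans
      (≡.sym (-ₙ-distrib k (-ₙ -ₙ j))) (cong (-ₙ k +ₙ_) (cong -ₙ_ (-ₙ-involutive j))))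

  M̃₋-action : Representation D
  M̃₋-action = record
    { space = ℤ^ (≡.setoid Basis)
    ; _·_ = λ (i , e) v → record
      { to = rotate i (reflect e (Func.to v)) ; cong = λ { ≡.refl → ≡.refl } }
    ; ·-cong = λ { {i , e} ≡.refl u≈v → rotate-cong i (reflect-cong e u≈v) }
    ; ·-+ᴹ = λ { (i , 0ℙ) u v (w k) → ≡.refl
               ; (i , 1ℙ) u v (w k) → neg-+ (Func.to u _) (Func.to v _) _ _
               ; (i , 0ℙ) u v w′ → ≡.refl
               ; (i , 1ℙ) u v w′ → ≡.refl }
    ; ·-*ₗ = λ { (i , 0ℙ) a v (w k) → ≡.refl
               ; (i , 1ℙ) a v (w k) → neg-* a (Func.to v _) _
               ; (i , 0ℙ) a v w′ → ≡.refl
               ; (i , 1ℙ) a v w′ → ≡.refl }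
    ; ·-identity = λ { v (w k) → cong (Func.to v ∘ w)
                         (≡.trans (cong (k +ₙ_) -ₙ0≡0) (+ₙ-identityʳ k))
                     ; v w′ → ≡.refl }
    ; ·-assoc = λ (i , e) (j , p) v b → ≡.trans
        (rotate-cong (i +ₙ (e ▹ j)) (reflect-reflect e p (Func.to v)) b)
        (≡.trans (rotate-rotate i (e ▹ j) _ b)
          (rotate-cong i (reflect-rotate e j (reflect p (Func.to v))) b))
    }

  M̃₋ : Lattice D
  M̃₋ = record
    { asModule = extend M̃₋-action
    ; finitelyGenerated = extend-finitelyGenerated M̃₋-action
        (E.finitelyGenerated point covers)
    ; torsionFree = ℤ^-torsionFree (≡.setoid Basis)
    }

  module M̃₋-basis where
    open LeftModule (Lattice.asModule M̃₋)
    open ModuleSum (Lattice.asModule M̃₋) using (sum)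
    private module V = Representation M̃₋-action

    e : Basis → Carrierᴹ
    e = E.δ

    private
      via : ∀ g {v u} → g V.· v ≈ᴹ u → R.δ g *ₗ v ≈ᴹ u
      via g {v} {u} eq = ≈ᴹ-trans {R.δ g *ₗ v} {g V.· v} {u} (R.Extend.δ-▷ M̃₋-action g v) eq

      δ-transport : ∀ {i j k l} → (i ≡ j → k ≡ l) → (k ≡ l → i ≡ j) →
                    Func.to (e (w j)) (w i) ≡ Func.to (e (w l)) (w k)
      δ-transport {i} {j} {k} {l} f g = cong (if_then 1ℤ else 0ℤ)
        (does-⇔ (mk⇔ f g) (i Fin.≟ j) (k Fin.≟ l))

      sub0 : ∀ k → k +ₙ -ₙ 0ₙ ≡ k
      sub0 k = ≡.trans (cong (k +ₙ_) -ₙ0≡0) (+ₙ-identityʳ k)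

    σ·wᵢ : ∀ i → R.δ σ *ₗ e (w i) ≈ᴹ e (w (i +ₙ 1ₙ))
    σ·wᵢ i = via σ {e (w i)} {e (w (i +ₙ 1ₙ))} λ
      { w′ → ≡.refl
      ; (w k) → δ-transport {k +ₙ -ₙ 1ₙ} {i} {k} {i +ₙ 1ₙ}
          (λ eq → ≡.trans (≡.sym (≡.trans (+ₙ-assoc k (-ₙ 1ₙ) 1ₙ)
             (≡.trans (cong (k +ₙ_) (+ₙ-inverseˡ 1ₙ)) (+ₙ-identityʳ k)))) (cong (_+ₙ 1ₙ) eq))
          (λ eq → ≡.trans (cong (_+ₙ -ₙ 1ₙ) eq) (≡.trans (+ₙ-assoc i 1ₙ (-ₙ 1ₙ))
             (≡.trans (cong (i +ₙ_) (+ₙ-inverseʳ 1ₙ)) (+ₙ-identityʳ i))))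
      }

    σ·w′ : R.δ σ *ₗ e w′ ≈ᴹ e w′
    σ·w′ = via σ {e w′} {e w′} λ { w′ → ≡.refl ; (w k) → ≡.refl }

    τ·wᵢ : ∀ i → R.δ τ *ₗ e (w i) ≈ᴹ -ᴹ e (w (-ₙ i))
    τ·wᵢ i = via τ {e (w i)} { -ᴹ e (w (-ₙ i)) } λ
      { w′ → ≡.refl
      ; (w k) → ≡.trans (ℤ.+-identityʳ _) (cong ℤ.-_ (δ-transport
          { -ₙ (k +ₙ -ₙ 0ₙ) } {i} {k} { -ₙ i }
          (λ eq → ≡.trans (≡.sym (≡.trans (-ₙ-involutive _) (sub0 k))) (cong -ₙ_ eq))
          (λ eq → ≡.trans (cong -ₙ_ (≡.trans (sub0 k) eq)) (-ₙ-involutive i))))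
      }

    τ·w′ : R.δ τ *ₗ e w′ ≈ᴹ e w′ +ᴹ -ᴹ sum (λ i → e (w i))
    τ·w′ = via τ {e w′} {e w′ +ᴹ -ᴹ sum (λ i → e (w i))} λ
      { w′ → cong (λ z → 1ℤ ℤ.+ ℤ.- z) (≡.sym (≡.trans (at w′)
          (ModuleSum.sum-zero ℤ¹ {n} _ λ i → ≡.refl)))
      ; (w k) → cong (λ z → 0ℤ ℤ.+ ℤ.- z) (≡.sym (≡.trans (at (w k))
          (≡.trans (ModuleSum.sum-single ℤ¹ {n} _ k λ i i≢k → E.δ-no (i≢k ∘ ≡.sym ∘ w-injective))
            (E.δ-yes {w k} ≡.refl))))
      }
      where
      at : ∀ b → Func.to (sum (λ i → e (w i))) b ≡ ℤ-sum (λ i → Func.to (e (w i)) b)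
      at = sum-at (≡.setoid Basis) {n} (λ i → e (w i))

{-# OPTIONS --safe #-}

-- Write n = 2h + 1, and an element of M̃₋ ⊕ ℤ[G/⟨τ⟩] as (v, c, b), where v
-- and c are the coordinates on the wₖ and w′, and b those on the cosets
-- σᵏ⟨τ⟩. With (S b)(k) = Σ_{1≤j≤h} b(k - j), send (v, c, b) to (r, m), where
--   m = Σ b + c,  r(σᵏτ) = vₖ - (S b)(k),  r(σᵏ) = b(k) - r(σᵏτ) - m.
-- This is inverted by b(k) = r(σᵏ) + r(σᵏτ) + m, vₖ = r(σᵏτ) + (S b)(k),
-- c = m - Σ b.
-- Equivariance under τ amounts to 1 + p + p̄ = Σᵢ σⁱ for p = σ + ⋯ + σʰ.

module Submission where

open import Defs
open import Data.Nat.Base using (ℕ; NonZero; _≤_)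
open import Data.Nat.Divisibility using (_∣_)
open import Relation.Nullary.Negation using (¬_)
open Dihedral using (D; ⟨τ⟩)

open import Algebra.Bundles using (AbelianGroup; Ring)
open import Algebra.Module.Bundles using (LeftModule)
open import Algebra.Module.Morphism.Structures using (module LeftModuleMorphisms)
open import Data.Fin.Base using (Fin; zero; suc; toℕ)
open import Data.Fin.Permutation using (Permutation; reverse)
open import Data.Integer.Base as ℤ using (ℤ; +_; -[1+_])
open import Data.Integer.Tactic.RingSolver using (solve-∀)
open import Data.Nat.Base as ℕ using (zero; suc)
open import Data.Nat.Divisibility using (m%n≡0⇒n∣m)
open import Data.Nat.DivMod using (_%_; _mod_; m≡m%n+[m/n]*n; m%n<n; [m+n]%n≡m%n)
open import Data.Parity.Base as ℙ using (Parity; 0ℙ; 1ℙ)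
open import Data.Product.Base using (_,_; proj₁; proj₂; ∃-syntax)
open import Data.Vec.Functional using (Vector)
open import Function.Base using (_∘_)
open import Function.Bundles using (Func; mk↔ₛ′)
open import Function.Definitions using (Injective; Surjective)
open import Level using (0ℓ)
open import Relation.Binary.PropositionalEquality as ≡ using (_≡_; cong; cong₂; subst)
open import Relation.Nullary.Decidable using (dec-true; isYes≗does; toWitness)
open import Relation.Nullary.Negation using (contradiction)

import Algebra.Properties.Group as GroupProperties
import Data.Bool.Base as Bool
import Data.Fin.Properties as Fin
import Data.Integer.Properties as ℤ
import Data.Nat.Properties as ℕ
import Data.Parity.Properties as ℙ
import Relation.Binary.Reasoning.Setoid as ≈-Reasoning

-- Integer sums over ranges of naturals.

module Σℤ = ModuleSum ℤ¹

-- Summands are functions on naturals restricted along `toℕ`, so a range can be split or given an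
-- equal length without casting `Fin` indices.
ℤ-sum-+ : ∀ m {n} (f : ℕ → ℤ) →
          ℤ-sum {m ℕ.+ n} (f ∘ toℕ) ≡ ℤ-sum {m} (f ∘ toℕ) ℤ.+ ℤ-sum {n} (f ∘ (m ℕ.+_) ∘ toℕ)
ℤ-sum-+ zero    f = ≡.sym (ℤ.+-identityˡ _)
ℤ-sum-+ (suc m) f = ≡.trans (cong (ℤ._+_ (f 0)) (ℤ-sum-+ m (f ∘ suc)))
  (≡.sym (ℤ.+-assoc (f 0) _ _))

ℤ-sum-reverse : ∀ n (f : ℕ → ℤ) →
                ℤ-sum {n} (f ∘ toℕ) ≡ ℤ-sum {n} (λ j → f (n ℕ.∸ suc (toℕ j)))
ℤ-sum-reverse n f = ≡.trans (Σℤ.sum-permute {n} {n} (f ∘ toℕ) reverse)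
  (Σℤ.sum-cong-≋ {n} λ j → cong f (Fin.opposite-prop j))

ℤ-sum-odd : ∀ h (f : ℕ → ℤ) →
            ℤ-sum {suc (h ℕ.+ h)} (f ∘ toℕ) ≡
            f 0 ℤ.+ (ℤ-sum {h} (λ j → f (suc (toℕ j))) ℤ.+
                     ℤ-sum {h} (λ j → f (suc (h ℕ.+ h) ℕ.∸ suc (toℕ j))))
ℤ-sum-odd h f = cong (ℤ._+_ (f 0)) (≡.trans (ℤ-sum-+ h (f ∘ suc))
  (cong (ℤ._+_ (ℤ-sum {h} (λ j → f (suc (toℕ j)))))
    -- Read backwards, the upper half has its j-th term (from 0) at index 1 + h + (h - 1 - j) = 2h -
    -- j, which is -(j + 1) modulo 2h + 1: the mirror image of the j-th term of the lower half.
    (≡.trans (ℤ-sum-reverse h (λ j → f (suc (h ℕ.+ j))))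
      (Σℤ.sum-cong-≋ {h} λ j → cong f (≡.trans
        (cong suc (≡.sym (ℕ.+-∸-assoc h (Fin.toℕ<n j))))
        (≡.sym (ℕ.+-∸-assoc 1 (ℕ.≤-trans (Fin.toℕ<n j) (ℕ.m≤m+n h h)))))))))

odd⇒≡1+h+h : ∀ n → ¬ (2 ∣ n) → ∃[ h ] n ≡ suc (h ℕ.+ h)
odd⇒≡1+h+h n 2∤n = n ℕ./ 2 , ≡.trans (m≡m%n+[m/n]*n n 2)
  (cong₂ ℕ._+_ (one (n % 2) ≡.refl (m%n<n n 2))
    (≡.trans (ℕ.*-comm (n ℕ./ 2) 2) (cong (n ℕ./ 2 ℕ.+_) (ℕ.+-identityʳ (n ℕ./ 2)))))
  where
  one : ∀ r → n % 2 ≡ r → r ℕ.< 2 → r ≡ 1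
  one zero          e _ = contradiction (m%n≡0⇒n∣m n 2 e) 2∤n
  one (suc zero)    _ _ = ≡.refl
  one (suc (suc _)) _ (ℕ.s≤s (ℕ.s≤s ()))

-- Arithmetic modulo n and sums over windows of residues.

module _ (n : ℕ) .{{_ : NonZero n}} where
  open Dihedral n hiding (D; ⟨τ⟩)

  ▹-▹-cancel : ∀ e i → e ▹ (e ▹ i) ≡ i
  ▹-▹-cancel e i = ≡.trans (▹-▹ e e i) (cong (_▹ i) (ℙ.p+p≡0ℙ e))

  +ₙ-cancelˡ : ∀ i j → i +ₙ (-ₙ i +ₙ j) ≡ j
  +ₙ-cancelˡ i j = ≡.trans (≡.sym (+ₙ-assoc i (-ₙ i) j))
    (≡.trans (cong (_+ₙ j) (+ₙ-inverseʳ i)) (+ₙ-identityˡ j))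

  -ₙ-cancelˡ : ∀ i j → -ₙ i +ₙ (i +ₙ j) ≡ j
  -ₙ-cancelˡ i j = ≡.trans (≡.sym (+ₙ-assoc (-ₙ i) i j))
    (≡.trans (cong (_+ₙ j) (+ₙ-inverseˡ i)) (+ₙ-identityˡ j))

  -- The permutation that left multiplication by σⁱτᵉ induces on the cosets σᵏ⟨τ⟩.
  affine : Fin n → Parity → Permutation n n
  affine i e = mk↔ₛ′ (λ k → i +ₙ (e ▹ k)) (λ k → e ▹ (-ₙ i +ₙ k))
    (λ k → ≡.trans (cong (i +ₙ_) (▹-▹-cancel e _)) (+ₙ-cancelˡ i k))
    (λ k → ≡.trans (cong (e ▹_) (-ₙ-cancelˡ i (e ▹ k))) (▹-▹-cancel e k))

  ℤ-sum-affine : ∀ i e (b : Vector ℤ n) → ℤ-sum (λ k → b (i +ₙ (e ▹ k))) ≡ ℤ-sum b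
  ℤ-sum-affine i e b = ≡.sym (Σℤ.sum-permute {n} {n} b (affine i e))

  mod-+ : ∀ k l → (k mod n) +ₙ (l mod n) ≡ (k ℕ.+ l) mod n
  mod-+ k l = begin
    (k mod n) +ₙ (l mod n)       ≡⟨ mod-+ˡ k (l mod n) ⟩
    (k ℕ.+ toℕ (l mod n)) mod n  ≡⟨ cong (_mod n) (ℕ.+-comm k _) ⟩
    (toℕ (l mod n) ℕ.+ k) mod n  ≡⟨ cong (λ z → (z ℕ.+ k) mod n) (toℕ-mod l) ⟩
    (l % n ℕ.+ k) mod n          ≡⟨ mod-cong (%-+ˡ l k) ⟩
    (l ℕ.+ k) mod n              ≡⟨ cong (_mod n) (ℕ.+-comm l k) ⟩
    (k ℕ.+ l) mod n              ∎
    where open ≡.≡-Reasoning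

  ∸-mod : ∀ {k} → k ℕ.≤ n → (n ℕ.∸ k) mod n ≡ -ₙ (k mod n)
  ∸-mod {k} k≤n = GroupProperties.inverseˡ-unique (AbelianGroup.group ℤ/n) _ _ (begin
    ((n ℕ.∸ k) mod n) +ₙ (k mod n)  ≡⟨ mod-+ (n ℕ.∸ k) k ⟩
    (n ℕ.∸ k ℕ.+ k) mod n           ≡⟨ cong (_mod n) (ℕ.m∸n+n≡m k≤n) ⟩
    n mod n                         ≡⟨ mod-cong ([m+n]%n≡m%n 0 n) ⟩
    0ₙ                              ∎)
    where open ≡.≡-Reasoning

  module Windows (h : ℕ) (n≡1+h+h : n ≡ suc (h ℕ.+ h)) where

    -- `before` is the operator S: with (σʲb)(k) = b(k - j) it is multiplication by p, and `after`
    -- is multiplication by p̄. The index `j` in `Fin h` stands for a shift by j + 1.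
    before after : Vector ℤ n → Fin n → ℤ
    before b k = ℤ-sum {h} (λ j → b (k +ₙ -ₙ (suc (toℕ j) mod n)))
    after  b k = ℤ-sum {h} (λ j → b (k +ₙ (suc (toℕ j) mod n)))

    before-cong : ∀ {b b′} → (∀ k → b k ≡ b′ k) → ∀ k → before b k ≡ before b′ k
    before-cong e k = Σℤ.sum-cong-≋ {h} λ j → e _

    before-+ : ∀ b b′ k → before (λ i → b i ℤ.+ b′ i) k ≡ before b k ℤ.+ before b′ k
    before-+ b b′ k = Σℤ.∑-distrib-+ {h} _ _

    before-translate : ∀ i b k → before (λ k → b (i +ₙ k)) k ≡ before b (i +ₙ k)
    before-translate i b k = Σℤ.sum-cong-≋ {h} λ j → cong b (≡.sym (+ₙ-assoc i k _))

    -- Negating the index reverses the direction of a window: τ turns p into p̄.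
    before-reflect : ∀ i b k → before (λ k → b (i +ₙ -ₙ k)) k ≡ after b (i +ₙ -ₙ k)
    before-reflect i b k = Σℤ.sum-cong-≋ {h} λ j → cong b (≡.trans
      (cong (i +ₙ_) (≡.trans (≡.sym (-ₙ-distrib k _)) (cong (-ₙ k +ₙ_) (-ₙ-involutive _))))
      (≡.sym (+ₙ-assoc i (-ₙ k) _)))

    -- This is 1 + p + p̄ = Σᵢ σⁱ evaluated at `k`: as n = 2h + 1, the residues are 0, 1, ..., h and
    -- -1, ..., -h, each occurring once.
    ℤ-sum-windows : ∀ b k → ℤ-sum b ≡ b k ℤ.+ (after b k ℤ.+ before b k)
    ℤ-sum-windows b k = begin
      ℤ-sum b
        ≡⟨ ℤ-sum-affine k 0ℙ b ⟨
      ℤ-sum (λ i → b (k +ₙ i))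
        ≡⟨ Σℤ.sum-cong-≋ {n} (λ i → cong (λ z → b (k +ₙ z)) (mod-toℕ i)) ⟨
      ℤ-sum {n} (f ∘ toℕ)
        -- Since `f` is defined on all naturals, only the length of the sum changes; the reduction
        -- modulo `n` inside `f` stays.
        ≡⟨ cong (λ m → ℤ-sum {m} (f ∘ toℕ)) n≡1+h+h ⟩
      ℤ-sum {suc (h ℕ.+ h)} (f ∘ toℕ)
        ≡⟨ ℤ-sum-odd h f ⟩
      f 0 ℤ.+ (after b k ℤ.+ ℤ-sum {h} (λ j → f (suc (h ℕ.+ h) ℕ.∸ suc (toℕ j))))
        ≡⟨ cong₂ (λ x y → x ℤ.+ (after b k ℤ.+ y)) (cong b (+ₙ-identityʳ k))
             (Σℤ.sum-cong-≋ {h} λ j → cong (λ z → b (k +ₙ z)) (wrap j)) ⟩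
      b k ℤ.+ (after b k ℤ.+ before b k) ∎
      where
      open ≡.≡-Reasoning
      f : ℕ → ℤ
      f j = b (k +ₙ (j mod n))
      wrap : ∀ (j : Fin h) → (suc (h ℕ.+ h) ℕ.∸ suc (toℕ j)) mod n ≡ -ₙ (suc (toℕ j) mod n)
      wrap j = ≡.trans (cong (λ m → (m ℕ.∸ suc (toℕ j)) mod n) (≡.sym n≡1+h+h))
        (∸-mod (subst (suc (toℕ j) ℕ.≤_) (≡.sym n≡1+h+h)
          (ℕ.m≤n⇒m≤1+n (ℕ.≤-trans (Fin.toℕ<n j) (ℕ.m≤m+n h h)))))

-- Linearity over the group ring from equivariance under the group.

module _ {R : Ring 0ℓ 0ℓ} (M : LeftModule R 0ℓ 0ℓ) where
  open Ring R using (-_; -‿inverseˡ)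
  open LeftModule M

  -‿*ₗ : ∀ r x → (- r) *ₗ x ≈ᴹ -ᴹ (r *ₗ x)
  -‿*ₗ r x = GroupProperties.inverseˡ-unique (AbelianGroup.group +ᴹ-abelianGroup) _ _
    (≈ᴹ-trans (≈ᴹ-sym (*ₗ-distribʳ x (- r) r))
      (≈ᴹ-trans (*ₗ-congʳ (-‿inverseˡ r)) (*ₗ-zeroˡ x)))

module _ {G : FiniteGroup} {A B : LeftModule (GroupRing.ℤ[G] G) 0ℓ 0ℓ} where
  private
    module G = FiniteGroup G
    module A = LeftModule A
    module B = LeftModule B
    module R = Ring (GroupRing.ℤ[G] G)
    module C = LeftModule (GroupRing.coefficients G)
  open GroupRing G using (δ; spanning)
  open LeftModuleMorphisms A.rawLeftModule B.rawLeftModule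
  open ≈-Reasoning B.≈ᴹ-setoid

  -- The scalars that `f` respects are closed under zero, sums and negatives, hence under integer
  -- multiples. They contain every `δ g`, and these span the group ring over ℤ.
  additive∧equivariant⇒isLeftModuleHomomorphism :
    (f : A.Carrierᴹ → B.Carrierᴹ) →
    (∀ {x y} → x A.≈ᴹ y → f x B.≈ᴹ f y) →
    (∀ x y → f (x A.+ᴹ y) B.≈ᴹ f x B.+ᴹ f y) →
    (∀ g x → f (δ g A.*ₗ x) B.≈ᴹ δ g B.*ₗ f x) →
    IsLeftModuleHomomorphism f
  additive∧equivariant⇒isLeftModuleHomomorphism f f-cong f-+ f-δ = record
    { +ᴹ-isGroupHomomorphism = record
      { isMonoidHomomorphism = record
        { isMagmaHomomorphism = record
          { isRelHomomorphism = record { cong = f-cong } ; homo = f-+ }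
        ; ε-homo = f-0
        }
      ; ⁻¹-homo = f-neg
      }
    ; *ₗ-homo = linear
    }
    where
    module +B = GroupProperties (AbelianGroup.group B.+ᴹ-abelianGroup)

    f-0 : f A.0ᴹ B.≈ᴹ B.0ᴹ
    f-0 = +B.identityˡ-unique (f A.0ᴹ) (f A.0ᴹ) (B.≈ᴹ-trans (B.≈ᴹ-sym (f-+ _ _)) (f-cong (A.+ᴹ-identityˡ A.0ᴹ)))

    f-neg : ∀ x → f (A.-ᴹ x) B.≈ᴹ B.-ᴹ f x
    f-neg x = +B.inverseˡ-unique _ _ (B.≈ᴹ-trans (B.≈ᴹ-sym (f-+ _ _))
      (B.≈ᴹ-trans (f-cong (A.-ᴹ‿inverseˡ x)) f-0))

    Commutes : R.Carrier → Set
    Commutes r = ∀ x → f (r A.*ₗ x) B.≈ᴹ r B.*ₗ f x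

    commutes-resp : ∀ {r s} → r R.≈ s → Commutes r → Commutes s
    commutes-resp {r} {s} r≈s c x = begin
      f (s A.*ₗ x)  ≈⟨ f-cong (A.*ₗ-congʳ {x} {r} {s} r≈s) ⟨
      f (r A.*ₗ x)  ≈⟨ c x ⟩
      r B.*ₗ f x    ≈⟨ B.*ₗ-congʳ {f x} {r} {s} r≈s ⟩
      s B.*ₗ f x    ∎

    commutes-0 : Commutes R.0#
    commutes-0 x = begin
      f (R.0# A.*ₗ x)  ≈⟨ f-cong (A.*ₗ-zeroˡ x) ⟩
      f A.0ᴹ           ≈⟨ f-0 ⟩
      B.0ᴹ             ≈⟨ B.*ₗ-zeroˡ (f x) ⟨
      R.0# B.*ₗ f x    ∎

    commutes-+ : ∀ {r s} → Commutes r → Commutes s → Commutes (r R.+ s)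
    commutes-+ {r} {s} c d x = begin
      f ((r R.+ s) A.*ₗ x)           ≈⟨ f-cong (A.*ₗ-distribʳ x r s) ⟩
      f (r A.*ₗ x A.+ᴹ s A.*ₗ x)     ≈⟨ f-+ _ _ ⟩
      f (r A.*ₗ x) B.+ᴹ f (s A.*ₗ x) ≈⟨ B.+ᴹ-cong (c x) (d x) ⟩
      r B.*ₗ f x B.+ᴹ s B.*ₗ f x     ≈⟨ B.*ₗ-distribʳ (f x) r s ⟨
      (r R.+ s) B.*ₗ f x             ∎

    commutes-neg : ∀ {r} → Commutes r → Commutes (R.- r)
    commutes-neg {r} c x = begin
      f ((R.- r) A.*ₗ x)   ≈⟨ f-cong (-‿*ₗ A r x) ⟩
      f (A.-ᴹ (r A.*ₗ x))  ≈⟨ f-neg _ ⟩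
      B.-ᴹ f (r A.*ₗ x)    ≈⟨ B.-ᴹ‿cong (c x) ⟩
      B.-ᴹ (r B.*ₗ f x)    ≈⟨ -‿*ₗ B r (f x) ⟨
      (R.- r) B.*ₗ f x     ∎

    commutes-ℕ : ∀ k {r} → Commutes r → Commutes (+ k C.*ₗ r)
    commutes-ℕ zero    {r} c = commutes-resp {R.0#} {+ 0 C.*ₗ r}
      (λ x → ≡.sym (ℤ.*-zeroˡ (Func.to r x))) commutes-0
    commutes-ℕ (suc k) {r} c = commutes-resp {r R.+ + k C.*ₗ r} {+ suc k C.*ₗ r}
      (λ x → ≡.sym (ℤ.suc-* (+ k) (Func.to r x)))
      (commutes-+ {r} {+ k C.*ₗ r} c (commutes-ℕ k {r} c))

    commutes-ℤ : ∀ a {r} → Commutes r → Commutes (a C.*ₗ r)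
    commutes-ℤ (+ k)    {r} c = commutes-ℕ k {r} c
    commutes-ℤ -[1+ k ] {r} c = commutes-resp {R.- (+ suc k C.*ₗ r)} { -[1+ k ] C.*ₗ r}
      (λ x → ℤ.neg-distribˡ-* (+ suc k) (Func.to r x))
      (commutes-neg {+ suc k C.*ₗ r} (commutes-ℕ (suc k) {r} c))

    commutes-sum : ∀ {n} (t : Vector R.Carrier n) → (∀ k → Commutes (t k)) →
                   Commutes (ModuleSum.sum (GroupRing.coefficients G) t)
    commutes-sum {zero}  t c = commutes-0
    commutes-sum {suc n} t c = commutes-+ {t zero} (c zero) (commutes-sum (t ∘ suc) (c ∘ suc))

    linear : ∀ r → Commutes r
    -- `spanning` asks that `r` vanish off the enumerated elements; `elt` reaches every element, so
    -- the condition is vacuous.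
    linear r with spanning G.elt r (λ x out → contradiction (G.elt-index x) (out (G.index x)))
    ... | c , r≈Σ = commutes-resp {ModuleSum.sum (GroupRing.coefficients G) t} {r} (λ x → ≡.sym (r≈Σ x))
      (commutes-sum t λ k → commutes-ℤ (c k) {δ (G.elt k)} (f-δ (G.elt k)))
      where
      t : Vector R.Carrier G.order
      t k = c k C.*ₗ δ (G.elt k)

-- Cosets of ⟨τ⟩ and the two maps.

module Isomorphism (n : ℕ) .{{_ : NonZero n}} (h : ℕ) (n≡1+h+h : n ≡ suc (h ℕ.+ h)) where
  open Dihedral n hiding (D; ⟨τ⟩)
  open Windows n h n≡1+h+h
  open Func using (to)
  open ≡.≡-Reasoning

  private
    module D = FiniteGroup (D n)
    module G/τ = FiniteGSet (leftCosets (D n) (⟨τ⟩ n))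
    module R = GroupRing (D n)

    domain codomain : Lattice (D n)
    domain   = M̃₋ n ⊕ ℤ[ D n / ⟨τ⟩ n ]
    codomain = ℤ[ D n ] ⊕ ℤ-trivial (D n)
    -- With these names and no type signature, forward-isLeftModuleHomomorphism
    -- is checked without unfolding the two modules.
    domainModule   = Lattice.asModule domain
    codomainModule = Lattice.asModule codomain

    module L = LeftModule (Lattice.asModule domain)
    module N = LeftModule (Lattice.asModule codomain)

  -- Together with `proj₁≡⇒≈` this identifies the coset of σⁱτᵉ with the residue i, so that
  -- functions on cosets become vectors over `Fin n`.
  ≈⇒proj₁≡ : ∀ {x y} → x G/τ.≈ y → proj₁ x ≡ proj₁ y
  ≈⇒proj₁≡ {i , e} {j , p} x≈y = begin
    i                                      ≡⟨ ▹-▹-cancel n e i ⟨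
    e ▹ (e ▹ i)                            ≡⟨ cong (e ▹_) (+ₙ-identityʳ (e ▹ i)) ⟨
    e ▹ ((e ▹ i) +ₙ 0ₙ)                    ≡⟨ cong (λ z → e ▹ ((e ▹ i) +ₙ z)) difference≡0 ⟨
    e ▹ ((e ▹ i) +ₙ (-ₙ (e ▹ i) +ₙ (e ▹ j)))
      ≡⟨ cong (e ▹_) (+ₙ-cancelˡ n (e ▹ i) (e ▹ j)) ⟩
    e ▹ (e ▹ j)                            ≡⟨ ▹-▹-cancel n e j ⟩
    j                                      ∎
    where
    -- ⟨τ⟩ decides membership by comparing the first coordinate with 0ₙ.
    difference≡0 : -ₙ (e ▹ i) +ₙ (e ▹ j) ≡ 0ₙ
    difference≡0 = toWitness {a? = κ Fin.≟ 0ₙ} (subst Bool.T (≡.sym (≡.trans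
      (isYes≗does (κ Fin.≟ 0ₙ))
      (dec-true (Subgroup._∈S? (⟨τ⟩ n) ((i , e) D.⁻¹ D.∙ (j , p))) x≈y))) _)
      where κ = -ₙ (e ▹ i) +ₙ (e ▹ j)

  -- The product (i , e)⁻¹(i , p) is the power of τ with exponent e + p.
  proj₁≡⇒≈ : ∀ i e p → (i , e) G/τ.≈ (i , p)
  proj₁≡⇒≈ i e p = subst (Generated (D n) τ)
    (cong (_, e ℙ.+ p) (≡.sym (+ₙ-inverseˡ (e ▹ i)))) (generated (e ℙ.+ p))
    where
    generated : ∀ e → Generated (D n) τ (0ₙ , e)
    generated 0ℙ = unit
    generated 1ℙ = gen

  onRotations : Func G/τ.setoid (≡.setoid ℤ) → Vector ℤ n
  onRotations f k = to f (k , 0ℙ)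

  total : L.Carrierᴹ → ℤ
  total (v , f) = ℤ-sum (onRotations f) ℤ.+ to v w′

  reflections rotations : L.Carrierᴹ → Vector ℤ n
  reflections (v , f) k = to v (w k) ℤ.- before (onRotations f) k
  rotations x@(v , f) k = to f (k , 0ℙ) ℤ.- reflections x k ℤ.- total x

  forward : L.Carrierᴹ → N.Carrierᴹ
  forward x = record
    { to = λ { (k , 0ℙ) → rotations x k ; (k , 1ℙ) → reflections x k }
    ; cong = λ { ≡.refl → ≡.refl }
    } , total x

  -- The b of the inverse map: the sum of `r` over the coset σᵏ⟨τ⟩ = {σᵏ, σᵏτ}, shifted by `m`.
  cosetSums : N.Carrierᴹ → Vector ℤ n
  cosetSums (r , m) k = to r (k , 0ℙ) ℤ.+ to r (k , 1ℙ) ℤ.+ m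

  backward : N.Carrierᴹ → L.Carrierᴹ
  backward y@(r , m) =
    record
      { to = λ { (w k) → to r (k , 1ℙ) ℤ.+ before (cosetSums y) k
               ; w′ → m ℤ.- ℤ-sum (cosetSums y) }
      ; cong = λ { ≡.refl → ≡.refl }
      } ,
    record
      { to = λ (k , _) → cosetSums y k
      ; cong = λ {i} {j} i≈j → cong (cosetSums y) (≈⇒proj₁≡ {i} {j} i≈j)
      }

  -- Congruence and additivity of the forward map.

  total-cong : ∀ {x y} → x L.≈ᴹ y → total x ≡ total y
  total-cong {v , f} {v′ , f′} (v≈v′ , f≈f′) =
    cong₂ ℤ._+_ (Σℤ.sum-cong-≋ {n} λ k → f≈f′ (k , 0ℙ)) (v≈v′ w′)

  reflections-cong : ∀ {x y} → x L.≈ᴹ y → ∀ k → reflections x k ≡ reflections y k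
  reflections-cong (v≈v′ , f≈f′) k =
    cong₂ ℤ._-_ (v≈v′ (w k)) (before-cong (λ i → f≈f′ (i , 0ℙ)) k)

  forward-cong : ∀ {x y} → x L.≈ᴹ y → forward x N.≈ᴹ forward y
  forward-cong {x} {y} x≈y =
    (λ { (k , 0ℙ) → cong₂ ℤ._-_ (cong₂ ℤ._-_ (proj₂ x≈y (k , 0ℙ)) (reflections-cong {x} {y} x≈y k))
                                (total-cong {x} {y} x≈y)
       ; (k , 1ℙ) → reflections-cong {x} {y} x≈y k }) ,
    total-cong {x} {y} x≈y

  total-+ : ∀ x y → total (x L.+ᴹ y) ≡ total x ℤ.+ total y
  total-+ (v , f) (v′ , f′) = ≡.trans
    (cong (ℤ._+ (to v w′ ℤ.+ to v′ w′)) (Σℤ.∑-distrib-+ {n} (onRotations f) (onRotations f′)))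
    (interchange (ℤ-sum (onRotations f)) (ℤ-sum (onRotations f′)) (to v w′) (to v′ w′))
    where
    interchange : ∀ a b c d → (a ℤ.+ b) ℤ.+ (c ℤ.+ d) ≡ (a ℤ.+ c) ℤ.+ (b ℤ.+ d)
    interchange = solve-∀

  reflections-+ : ∀ x y k → reflections (x L.+ᴹ y) k ≡ reflections x k ℤ.+ reflections y k
  reflections-+ (v , f) (v′ , f′) k = ≡.trans
    (cong (ℤ._-_ (to v (w k) ℤ.+ to v′ (w k))) (before-+ (onRotations f) (onRotations f′) k))
    (interchange (to v (w k)) (to v′ (w k)) _ _)
    where
    interchange : ∀ a b c d → (a ℤ.+ b) ℤ.- (c ℤ.+ d) ≡ (a ℤ.- c) ℤ.+ (b ℤ.- d)
    interchange = solve-∀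

  forward-+ : ∀ x y → forward (x L.+ᴹ y) N.≈ᴹ forward x N.+ᴹ forward y
  forward-+ x@(_ , f) y@(_ , f′) =
    (λ { (k , 0ℙ) → ≡.trans
           (cong₂ (λ a m → to f (k , 0ℙ) ℤ.+ to f′ (k , 0ℙ) ℤ.- a ℤ.- m) (reflections-+ x y k) (total-+ x y))
           (interchange (to f (k , 0ℙ)) (to f′ (k , 0ℙ)) (reflections x k) _ (total x) _)
       ; (k , 1ℙ) → reflections-+ x y k }) ,
    total-+ x y
    where
    interchange : ∀ a a′ b b′ c c′ → a ℤ.+ a′ ℤ.- (b ℤ.+ b′) ℤ.- (c ℤ.+ c′) ≡
                                     (a ℤ.- b ℤ.- c) ℤ.+ (a′ ℤ.- b′ ℤ.- c′)
    interchange = solve-∀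

  -- Equivariance under the dihedral group.

  private
    V = M̃₋-action n
    P = R.permutation (leftCosets (D n) (⟨τ⟩ n))
    module V = Representation V
    module P = Representation P
    module Reg = Representation (R.permutation (leftRegular (D n)))

  infixr 7 _·_

  _·_ : D.Carrier → L.Carrierᴹ → L.Carrierᴹ
  g · (v , f) = g V.· v , g P.· f

  -- A scalar acts by a sum over the whole group, which for `δ g` has a single nonzero term. This
  -- and `δ-*ₗ-codomain` reduce equivariance to the explicit actions.
  δ-*ₗ-domain : ∀ g x → R.δ g L.*ₗ x L.≈ᴹ g · x
  δ-*ₗ-domain g (v , f) = R.Extend.δ-▷ V g v , R.Extend.δ-▷ P g f

  δ-*ₗ-codomain : ∀ g r m → R.δ g N.*ₗ (r , m) N.≈ᴹ (g Reg.· r , m)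
  δ-*ₗ-codomain g r m =
    -- On the first summand scalars act by convolution, which agrees pointwise with the extension of
    -- the left regular action.
    (λ x → ≡.trans (≡.sym (sum-at D.setoid {D.order} _ x))
                   (R.Extend.δ-▷ (R.permutation (leftRegular (D n))) g r x)) ,
    R.Extend.δ-▷ (proj₁ trivial) g m
    where
    -- The representation behind ℤ-trivial has no name outside Defs.
    trivial : ∃[ V ] Lattice.asModule (ℤ-trivial (D n)) ≡ R.extend V
    trivial = _ , ≡.refl

  -- The first coordinate of (i , e)⁻¹ ∙ (k , p).
  preimage : D.Carrier → Fin n → Fin n
  preimage (i , e) k = -ₙ (e ▹ i) +ₙ (e ▹ k)

  -- Translation by the inverse of a reflection sends the rotation σᵏ to a reflection; the rotation
  -- in the same coset replaces it as representative.
  onRotations-· : ∀ g f k → onRotations (g P.· f) k ≡ onRotations f (preimage g k)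
  onRotations-· (i , e) f k = Func.cong f (proj₁≡⇒≈ (preimage (i , e) k) (e ℙ.+ 0ℙ) 0ℙ)

  -- `preimage g` permutes the residues, so Σ b is unchanged, and σ and τ both fix the coefficient
  -- of `w′`.
  total-· : ∀ g x → total (g · x) ≡ total x
  total-· g@(i , e) (v , f) = cong₂ ℤ._+_
    (≡.trans (Σℤ.sum-cong-≋ {n} (onRotations-· g f)) (ℤ-sum-affine n (-ₙ (e ▹ i)) e (onRotations f)))
    (fixed e)
    where
    fixed : ∀ e → to ((i , e) V.· v) w′ ≡ to v w′
    fixed 0ℙ = ≡.refl
    fixed 1ℙ = ≡.refl

  -- Left multiplication by σⁱ maps reflections to reflections and commutes with p.
  reflections-rotation : ∀ i x k → reflections ((i , 0ℙ) · x) k ≡ reflections x (preimage (i , 0ℙ) k)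
  reflections-rotation i (v , f) k = cong₂ ℤ._-_
    (cong (to v ∘ w) (+ₙ-comm k (-ₙ i)))
    (≡.trans (before-cong (onRotations-· (i , 0ℙ) f) k) (before-translate (-ₙ i) (onRotations f) k))

  -- Left multiplication by σⁱτ exchanges reflections and rotations, which dictates the formula for
  -- `rotations`. The action of τ contributes -v - c and turns p into p̄; the windows identity
  -- reconciles the two sides.
  reflections-reflection : ∀ i x k → reflections ((i , 1ℙ) · x) k ≡ rotations x (preimage (i , 1ℙ) k)
  reflections-reflection i x@(v , f) k = begin
    (ℤ.- to v (w (-ₙ (k +ₙ -ₙ i))) ℤ.- c) ℤ.- before (onRotations ((i , 1ℙ) P.· f)) k
      ≡⟨ cong₂ (λ j s → (ℤ.- to v (w j) ℤ.- c) ℤ.- s)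
           (≡.trans (≡.sym (-ₙ-distrib k (-ₙ i))) (+ₙ-comm (-ₙ k) (-ₙ -ₙ i)))
           (≡.trans (before-cong (onRotations-· (i , 1ℙ) f) k) (before-reflect (-ₙ -ₙ i) b k)) ⟩
    (ℤ.- to v (w κ) ℤ.- c) ℤ.- after b κ
      -- `b κ` and `before b κ` are added and subtracted so that the full cyclic sum Σ b appears,
      -- split into its windows around `κ`.
      ≡⟨ rearrange (to v (w κ)) c (b κ) (after b κ) (before b κ) ⟩
    b κ ℤ.- (to v (w κ) ℤ.- before b κ) ℤ.- ((b κ ℤ.+ (after b κ ℤ.+ before b κ)) ℤ.+ c)
      ≡⟨ cong (λ s → b κ ℤ.- reflections x κ ℤ.- (s ℤ.+ c)) (ℤ-sum-windows b κ) ⟨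
    rotations x κ ∎
    where
    κ = preimage (i , 1ℙ) k
    b = onRotations f
    c = to v w′
    rearrange : ∀ v c b s s′ → (ℤ.- v ℤ.- c) ℤ.- s ≡ b ℤ.- (v ℤ.- s′) ℤ.- ((b ℤ.+ (s ℤ.+ s′)) ℤ.+ c)
    rearrange = solve-∀

  -- The relation b(k) = r(σᵏ) + r(σᵏτ) + m is symmetric in the two coefficients of r, so for a
  -- reflection `g` the formula for `reflections` forces the one for `rotations`.
  forward-· : ∀ g x → forward (g · x) N.≈ᴹ (g Reg.· proj₁ (forward x) , total x)
  forward-· g x@(v , f) = at g , total-· g x
    where
    a-[a-b-c]-c≡b : ∀ a b c → a ℤ.- (a ℤ.- b ℤ.- c) ℤ.- c ≡ b
    a-[a-b-c]-c≡b = solve-∀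
    rotations-· : ∀ g k {a} → reflections (g · x) k ≡ a →
                  rotations (g · x) k ≡ to f (preimage g k , 0ℙ) ℤ.- a ℤ.- total x
    rotations-· g k e = cong₂ ℤ._-_ (cong₂ ℤ._-_ (onRotations-· g f k) e) (total-· g x)
    at : ∀ g y → to (proj₁ (forward (g · x))) y ≡ to (g Reg.· proj₁ (forward x)) y
    at (i , 0ℙ) (k , 0ℙ) = rotations-· (i , 0ℙ) k (reflections-rotation i x k)
    at (i , 0ℙ) (k , 1ℙ) = reflections-rotation i x k
    at (i , 1ℙ) (k , 0ℙ) = ≡.trans (rotations-· (i , 1ℙ) k (reflections-reflection i x k))
      (a-[a-b-c]-c≡b (to f (preimage (i , 1ℙ) k , 0ℙ)) _ (total x))
    at (i , 1ℙ) (k , 1ℙ) = reflections-reflection i x k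

  forward-δ : ∀ g x → forward (R.δ g L.*ₗ x) N.≈ᴹ R.δ g N.*ₗ forward x
  forward-δ g x = N.≈ᴹ-trans {forward δx} {forward (g · x)} {δy}
    (forward-cong {δx} {g · x} (δ-*ₗ-domain g x))
    (N.≈ᴹ-trans {forward (g · x)} {gy} {δy} (forward-· g x)
      (N.≈ᴹ-sym {δy} {gy} (δ-*ₗ-codomain g (proj₁ (forward x)) (total x))))
    where
    δx = R.δ g L.*ₗ x
    δy = R.δ g N.*ₗ forward x
    gy = g Reg.· proj₁ (forward x) , total x

  -- The two maps are mutually inverse.

  private
    a-b-c+b+c≡a : ∀ a b c → (a ℤ.- b ℤ.- c) ℤ.+ b ℤ.+ c ≡ a
    a-b-c+b+c≡a = solve-∀

    a-b+b≡a : ∀ a b → a ℤ.- b ℤ.+ b ≡ a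
    a-b+b≡a = solve-∀

    a+b-b≡a : ∀ a b → a ℤ.+ b ℤ.- b ≡ a
    a+b-b≡a = solve-∀

    a+b-a≡b : ∀ a b → a ℤ.+ b ℤ.- a ≡ b
    a+b-a≡b = solve-∀

    a+b+c-b-c≡a : ∀ a b c → a ℤ.+ b ℤ.+ c ℤ.- b ℤ.- c ≡ a
    a+b+c-b-c≡a = solve-∀

    b+[a-b]≡a : ∀ a b → b ℤ.+ (a ℤ.- b) ≡ a
    b+[a-b]≡a = solve-∀

  -- Recovering b comes first: the corrections S b and Σ b made by `backward` are then those made by
  -- `forward`, and they cancel.
  cosetSums-forward : ∀ x k → cosetSums (forward x) k ≡ onRotations (proj₂ x) k
  cosetSums-forward x@(_ , f) k = a-b-c+b+c≡a (to f (k , 0ℙ)) (reflections x k) (total x)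

  backward-forward : ∀ x → backward (forward x) L.≈ᴹ x
  backward-forward x@(v , f) =
    (λ { (w k) → ≡.trans (cong (ℤ._+_ (reflections x k)) (before-cong (cosetSums-forward x) k))
                         (a-b+b≡a (to v (w k)) (before (onRotations f) k))
       ; w′ → ≡.trans (cong (ℤ._-_ (total x)) (Σℤ.sum-cong-≋ {n} (cosetSums-forward x)))
                      (a+b-a≡b (ℤ-sum (onRotations f)) (to v w′)) }) ,
    λ (k , e) → ≡.trans (cosetSums-forward x k) (Func.cong f (proj₁≡⇒≈ k 0ℙ e))

  total-backward : ∀ r m → total (backward (r , m)) ≡ m
  total-backward r m = b+[a-b]≡a m (ℤ-sum (cosetSums (r , m)))

  reflections-backward : ∀ r m k → reflections (backward (r , m)) k ≡ to r (k , 1ℙ)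
  reflections-backward r m k = a+b-b≡a (to r (k , 1ℙ)) (before (cosetSums (r , m)) k)

  forward-backward : ∀ y → forward (backward y) N.≈ᴹ y
  forward-backward y@(r , m) =
    (λ { (k , 0ℙ) → ≡.trans
           (cong₂ (λ a z → cosetSums y k ℤ.- a ℤ.- z) (reflections-backward r m k) (total-backward r m))
           (a+b+c-b-c≡a (to r (k , 0ℙ)) (to r (k , 1ℙ)) m)
       ; (k , 1ℙ) → reflections-backward r m k }) ,
    total-backward r m

  backward-cong : ∀ {y z} → y N.≈ᴹ z → backward y L.≈ᴹ backward z
  backward-cong {r , m} {r′ , m′} (r≈r′ , m≡m′) =
    (λ { (w k) → cong₂ ℤ._+_ (r≈r′ (k , 1ℙ)) (before-cong sums k)
       ; w′ → cong₂ ℤ._-_ m≡m′ (Σℤ.sum-cong-≋ {n} sums) }) ,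
    λ (k , _) → sums k
    where
    sums : ∀ k → cosetSums (r , m) k ≡ cosetSums (r′ , m′) k
    sums k = cong₂ ℤ._+_ (cong₂ ℤ._+_ (r≈r′ (k , 0ℙ)) (r≈r′ (k , 1ℙ))) m≡m′

  -- Assembly of the lattice isomorphism.

  open LeftModuleMorphisms L.rawLeftModule N.rawLeftModule

  forward-isLeftModuleHomomorphism : IsLeftModuleHomomorphism forward
  forward-isLeftModuleHomomorphism = additive∧equivariant⇒isLeftModuleHomomorphism
    {G = D n} {A = domainModule} {B = codomainModule}
    forward (λ {x} {y} → forward-cong {x} {y}) forward-+ forward-δ

  forward-injective : Injective L._≈ᴹ_ N._≈ᴹ_ forward
  forward-injective {x} {y} fx≈fy = L.≈ᴹ-trans {x} {backward (forward x)} {y}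
    (L.≈ᴹ-sym {backward (forward x)} {x} (backward-forward x))
    (L.≈ᴹ-trans {backward (forward x)} {backward (forward y)} {y}
      (backward-cong {forward x} {forward y} fx≈fy) (backward-forward y))

  forward-surjective : Surjective L._≈ᴹ_ N._≈ᴹ_ forward
  forward-surjective y = backward y , λ {z} z≈ →
    N.≈ᴹ-trans {forward z} {forward (backward y)} {y}
      (forward-cong {z} {backward y} z≈) (forward-backward y)

  isomorphism : domain ≅ codomain
  isomorphism = record
    { to = forward
    ; isIsomorphism = record
      { isLeftModuleMonomorphism = record
        { isLeftModuleHomomorphism = forward-isLeftModuleHomomorphism
        ; injective = λ {x} {y} → forward-injective {x} {y}
        }
      ; surjective = forward-surjective
      }
    }

theorem3p5 : ∀ (n : ℕ) .{{_ : NonZero n}} → 3 ≤ n → ¬ (2 ∣ n) →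
    M̃₋ n ⊕ ℤ[ D n / ⟨τ⟩ n ] ≅ ℤ[ D n ] ⊕ ℤ-trivial (D n)
theorem3p5 n _ 2∤n =
  let h , n≡1+h+h = odd⇒≡1+h+h n 2∤n in Isomorphism.isomorphism n h n≡1+h+h
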